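{- Let $G$ be a connected graph (simple, locally finite) with minimum degree $\delta$. If $G$ has non-negative Bakry-Émery curvature, then $G$ is $(\delta-1)$-edge-connected.
   Context: All graphs are simple and locally finite (every vertex has finite degree), possibly infinite. Let $G=(V,E)$ be such a graph. If $G$ has at least two vertices, it is called $l$-edge-connected if $G-F$ is connected for every set $F\subset E$ of fewer than $l$ edges (here $G-F$ is obtained from $G$ by deleting the edges in $F$ and keeping all vertices). The edge-connectivity of $G$ is the greatest integer $l$ such that $G$ is $l$-edge-connected; the edge-connectivity of a single vertex is defined to be $0$. Bakry-Émery curvature: for $f:V\to\mathbb{R}$ and $x\in V$ put $\Delta f(x):=\sum_{y\sim x}(f(y)-f(x))$, where $y\sim x$ means that $y$ is adjacent to $x$. For $f,g:V\to\mathbb{R}$ put $$\Gamma(f,g)(x):=\tfrac12\left(\Delta(fg)-(\Delta f)g-f(\Delta g)\right)(x),$$ $$\Gamma_2(f,g)(x):=\tfrac12\left(\Delta\Gamma(f,g)-\Gamma(\Delta f,g)-\Gamma(f,\Delta g)\right)(x),$$ and $\Gamma(f):=\Gamma(f,f)$, $\Gamma_2(f):=\Gamma_2(f,f)$. For $K\in\mathbb{R}$, $G$ satisfies $CD(\infty,K)$ at $x$ if $\Gamma_2(f)(x)\ge K\,\Gamma(f)(x)$ for every $f:V\to\mathbb{R}$. The Bakry-Émery curvature of $G$ at $x$ is $K_{BE}(G,x):=\sup\{K: G\text{ satisfies }CD(\infty,K)\text{ at }x\}$, and the Bakry-Émery curvature of $G$ is $K_{BE}(G):=\inf_{x\in V}K_{BE}(G,x)$.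 Non-negative Bakry-Émery curvature means $K_{BE}(G)\ge 0$, equivalently $G$ satisfies $CD(\infty,0)$ at every vertex. -}

module Defs where

open import Data.List using (List; length; map; foldr)
open import Data.List.Membership.Propositional using (_∈_)
open import Data.List.Relation.Unary.Any as Any using (Any)
open import Data.List.Relation.Unary.Unique.Propositional using (Unique)
open import Data.Nat as ℕ using (ℕ; _⊔_)
import Data.Nat.Properties as ℕ
open import Data.Product using (Σ; ∃₂; ∃-syntax; _×_; _,_)
open import Data.Rational as ℚ using (ℚ; 0ℚ; 1ℚ; ½; ∣_∣)
import Data.Rational.Properties as ℚ
open import Data.Rational.Solver using (module +-*-Solver)
open import Data.Sum using (_⊎_; swap)
open import Function using (_∘_)
open import Function.Bundles using (_⇔_)
open import Relation.Binary.Construct.Closure.ReflexiveTransitive using (Star)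
open import Relation.Binary.PropositionalEquality
  using (_≡_; _≢_; refl; sym; trans; cong; subst; subst₂)
open import Relation.Nullary using (¬_)

IsCauchy : (ℕ → ℚ) → Set
IsCauchy s = ∀ ε → 0ℚ ℚ.< ε →
  ∃[ N ] (∀ m n → N ℕ.≤ m → N ℕ.≤ n → ∣ s m ℚ.- s n ∣ ℚ.< ε)

private

  ½*-pos : ∀ {ε} → 0ℚ ℚ.< ε → 0ℚ ℚ.< ½ ℚ.* ε
  ½*-pos {ε} ε>0 = ℚ.*-monoʳ-<-pos ½ ε>0

  ½+½ : ∀ ε → ½ ℚ.* ε ℚ.+ ½ ℚ.* ε ≡ ε
  ½+½ ε = trans (sym (ℚ.*-distribʳ-+ ε ½ ½)) (ℚ.*-identityˡ ε)

  const-cauchy : ∀ q → IsCauchy (λ _ → q)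
  const-cauchy q ε ε>0 =
    0 , λ _ _ _ _ → subst (ℚ._< ε) (cong ∣_∣ (sym (ℚ.+-inverseʳ q))) ε>0

  neg-cauchy : ∀ {s} → IsCauchy s → IsCauchy (λ n → ℚ.- s n)
  neg-cauchy {s} cs ε ε>0 with cs ε ε>0
  ... | N , h = N , λ m n N≤m N≤n →
    subst (ℚ._< ε)
      (trans (sym (ℚ.∣-p∣≡∣p∣ (s m ℚ.- s n)))
             (cong ∣_∣ (ℚ.neg-distrib-+ (s m) (ℚ.- s n))))
      (h m n N≤m N≤n)

  +-cauchy : ∀ {s t} → IsCauchy s → IsCauchy t → IsCauchy (λ n → s n ℚ.+ t n)
  +-cauchy {s} {t} cs ct ε ε>0
    with cs (½ ℚ.* ε) (½*-pos ε>0) | ct (½ ℚ.* ε) (½*-pos ε>0)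
  ... | N , h | M , k = N ⊔ M , λ m n m≥ n≥ →
    subst₂ ℚ._<_ (cong ∣_∣ (sym (regroup (s m) (t m) (s n) (t n)))) (½+½ ε)
      (ℚ.≤-<-trans (ℚ.∣p+q∣≤∣p∣+∣q∣ (s m ℚ.- s n) (t m ℚ.- t n))
        (ℚ.+-mono-<
          (h m n (ℕ.m⊔n≤o⇒m≤o N M m≥) (ℕ.m⊔n≤o⇒m≤o N M n≥))
          (k m n (ℕ.m⊔n≤o⇒n≤o N M m≥) (ℕ.m⊔n≤o⇒n≤o N M n≥))))
    where
    open +-*-Solver
    regroup : ∀ a b c d →
      (a ℚ.+ b) ℚ.- (c ℚ.+ d) ≡ (a ℚ.- c) ℚ.+ (b ℚ.- d)
    regroup = solve 4
      (λ a b c d → (a :+ b) :- (c :+ d) := (a :- c) :+ (b :- d)) refl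

  eventually-bounded : ∀ {s} → IsCauchy s →
    ∃[ B ] 0ℚ ℚ.< B × ∃[ N ] (∀ n → N ℕ.≤ n → ∣ s n ∣ ℚ.≤ B)
  eventually-bounded {s} cs with cs 1ℚ (ℚ.positive⁻¹ 1ℚ)
  ... | N , h = 1ℚ ℚ.+ ∣ s N ∣
              , ℚ.+-mono-<-≤ (ℚ.positive⁻¹ 1ℚ) (ℚ.0≤∣p∣ (s N))
              , N , λ n N≤n →
    subst (ℚ._≤ _) (cong ∣_∣ (cancel (s n) (s N)))
      (ℚ.≤-trans (ℚ.∣p+q∣≤∣p∣+∣q∣ (s n ℚ.- s N) (s N))
        (ℚ.+-monoˡ-≤ ∣ s N ∣ (ℚ.<⇒≤ (h n N N≤n ℕ.≤-refl))))
    where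
    open +-*-Solver
    cancel : ∀ a b → (a ℚ.- b) ℚ.+ b ≡ a
    cancel = solve 2 (λ a b → (a :- b) :+ b := a) refl

  shrink : ∀ D ε → 0ℚ ℚ.< D → 0ℚ ℚ.< ε → ∃[ η ] 0ℚ ℚ.< η × D ℚ.* η ≡ ε
  shrink D ε D>0 ε>0 = ℚ.1/ D ℚ.* ε
    , subst (ℚ._< ℚ.1/ D ℚ.* ε) (ℚ.*-zeroʳ (ℚ.1/ D))
        (ℚ.*-monoʳ-<-pos (ℚ.1/ D) {{ℚ.1/pos⇒pos D}} ε>0)
    , trans (sym (ℚ.*-assoc D (ℚ.1/ D) ε))
        (trans (cong (ℚ._* ε) (ℚ.*-inverseʳ D)) (ℚ.*-identityˡ ε))
    where
    instance
      D-pos : ℚ.Positive D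
      D-pos = ℚ.positive D>0
      D-nonZero : ℚ.NonZero D
      D-nonZero = ℚ.pos⇒nonZero D

  prod-bound : ∀ D η p q → 0ℚ ℚ.< D → ∣ p ∣ ℚ.≤ D → ∣ q ∣ ℚ.< η →
    ∣ p ℚ.* q ∣ ℚ.< D ℚ.* η
  prod-bound D η p q D>0 p≤D q<η =
    subst (ℚ._< D ℚ.* η) (sym (ℚ.∣p*q∣≡∣p∣*∣q∣ p q))
      (ℚ.≤-<-trans
        (ℚ.*-monoʳ-≤-nonNeg ∣ q ∣ {{ℚ.nonNegative (ℚ.0≤∣p∣ q)}} p≤D)
        (ℚ.*-monoʳ-<-pos D {{ℚ.positive D>0}} q<η))

  *-regroup : ∀ a b c d →
    a ℚ.* b ℚ.- c ℚ.* d ≡ a ℚ.* (b ℚ.- d) ℚ.+ d ℚ.* (a ℚ.- c)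
  *-regroup = solve 4
    (λ a b c d → a :* b :- c :* d := a :* (b :- d) :+ d :* (a :- c)) refl
    where open +-*-Solver

  EventuallyBoundedBy : (ℕ → ℚ) → ℚ → Set
  EventuallyBoundedBy s B = ∃[ N ] (∀ n → N ℕ.≤ n → ∣ s n ∣ ℚ.≤ B)

  EventuallyWithin : (ℕ → ℚ) → ℚ → Set
  EventuallyWithin s ε =
    ∃[ N ] (∀ m n → N ℕ.≤ m → N ℕ.≤ n → ∣ s m ℚ.- s n ∣ ℚ.< ε)

  *-within : ∀ s t ε B C η θ → 0ℚ ℚ.< B → 0ℚ ℚ.< C →
    EventuallyBoundedBy s B → EventuallyBoundedBy t C →
    B ℚ.* η ≡ ½ ℚ.* ε → C ℚ.* θ ≡ ½ ℚ.* ε →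
    EventuallyWithin t η → EventuallyWithin s θ →
    EventuallyWithin (λ n → s n ℚ.* t n) ε
  *-within s t ε B C η θ B>0 C>0 (N₁ , hB) (N₂ , hC) Bη Cθ (N₃ , ht) (N₄ , hs) =
    (N₁ ⊔ N₂) ⊔ (N₃ ⊔ N₄) , λ m n m≥ n≥ →
    subst₂ ℚ._<_ (cong ∣_∣ (sym (*-regroup (s m) (t m) (s n) (t n)))) (½+½ ε)
      (ℚ.≤-<-trans
        (ℚ.∣p+q∣≤∣p∣+∣q∣ (s m ℚ.* (t m ℚ.- t n)) (t n ℚ.* (s m ℚ.- s n)))
        (ℚ.+-mono-<
          (subst (∣ s m ℚ.* (t m ℚ.- t n) ∣ ℚ.<_) Bη
            (prod-bound B η (s m) (t m ℚ.- t n) B>0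
              (hB m (ℕ.m⊔n≤o⇒m≤o N₁ N₂ (left m≥)))
              (ht m n (ℕ.m⊔n≤o⇒m≤o N₃ N₄ (right m≥))
                      (ℕ.m⊔n≤o⇒m≤o N₃ N₄ (right n≥)))))
          (subst (∣ t n ℚ.* (s m ℚ.- s n) ∣ ℚ.<_) Cθ
            (prod-bound C θ (t n) (s m ℚ.- s n) C>0
              (hC n (ℕ.m⊔n≤o⇒n≤o N₁ N₂ (left n≥)))
              (hs m n (ℕ.m⊔n≤o⇒n≤o N₃ N₄ (right m≥))
                      (ℕ.m⊔n≤o⇒n≤o N₃ N₄ (right n≥)))))))
    where
    left : ∀ {k} → (N₁ ⊔ N₂) ⊔ (N₃ ⊔ N₄) ℕ.≤ k → N₁ ⊔ N₂ ℕ.≤ k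
    left = ℕ.m⊔n≤o⇒m≤o (N₁ ⊔ N₂) (N₃ ⊔ N₄)
    right : ∀ {k} → (N₁ ⊔ N₂) ⊔ (N₃ ⊔ N₄) ℕ.≤ k → N₃ ⊔ N₄ ℕ.≤ k
    right = ℕ.m⊔n≤o⇒n≤o (N₁ ⊔ N₂) (N₃ ⊔ N₄)

  *-cauchy : ∀ {s t} → IsCauchy s → IsCauchy t → IsCauchy (λ n → s n ℚ.* t n)
  *-cauchy {s} {t} cs ct ε ε>0 =
    from-bounds (eventually-bounded {s} cs) (eventually-bounded {t} ct)
    where
    from-bounds :
      (∃[ B ] 0ℚ ℚ.< B × EventuallyBoundedBy s B) →
      (∃[ C ] 0ℚ ℚ.< C × EventuallyBoundedBy t C) →
      EventuallyWithin (λ n → s n ℚ.* t n) ε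
    from-bounds (B , B>0 , hB) (C , C>0 , hC) =
      from-radii (shrink B (½ ℚ.* ε) B>0 (½*-pos ε>0))
                 (shrink C (½ ℚ.* ε) C>0 (½*-pos ε>0))
      where
      from-radii :
        (∃[ η ] 0ℚ ℚ.< η × B ℚ.* η ≡ ½ ℚ.* ε) →
        (∃[ θ ] 0ℚ ℚ.< θ × C ℚ.* θ ≡ ½ ℚ.* ε) →
        EventuallyWithin (λ n → s n ℚ.* t n) ε
      from-radii (η , η>0 , Bη) (θ , θ>0 , Cθ) =
        *-within s t ε B C η θ B>0 C>0 hB hC Bη Cθ (ct η η>0) (cs θ θ>0)

record ℝ : Set where
  constructor mkℝ
  field
    seq    : ℕ → ℚ
    cauchy : IsCauchy seq

open ℝ public

fromℚ : ℚ → ℝ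
fromℚ q = mkℝ (λ _ → q) (const-cauchy q)

0ᴿ ½ᴿ : ℝ
0ᴿ = fromℚ 0ℚ
½ᴿ = fromℚ ½

infixl 6 _+ᴿ_ _-ᴿ_
infixl 7 _*ᴿ_
infix  8 -ᴿ_
infix  4 _<ᴿ_ _≤ᴿ_

-ᴿ_ : ℝ → ℝ
-ᴿ x = mkℝ (λ n → ℚ.- seq x n) (neg-cauchy {seq x} (cauchy x))

_+ᴿ_ _-ᴿ_ _*ᴿ_ : ℝ → ℝ → ℝ
x +ᴿ y = mkℝ (λ n → seq x n ℚ.+ seq y n)
             (+-cauchy {seq x} {seq y} (cauchy x) (cauchy y))
x -ᴿ y = x +ᴿ (-ᴿ y)
x *ᴿ y = mkℝ (λ n → seq x n ℚ.* seq y n)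
             (*-cauchy {seq x} {seq y} (cauchy x) (cauchy y))

_<ᴿ_ _≤ᴿ_ : ℝ → ℝ → Set
x <ᴿ y = ∃[ ε ] 0ℚ ℚ.< ε ×
  ∃[ N ] (∀ n → N ℕ.≤ n → seq x n ℚ.+ ε ℚ.< seq y n)
x ≤ᴿ y = ¬ (y <ᴿ x)

sumᴿ : List ℝ → ℝ
sumᴿ = foldr _+ᴿ_ 0ᴿ

-- An extended real u ∈ [-∞, ∞] is represented by the set of reals
-- strictly below it: U a means a < u.
ℝ∞ : Set₁
ℝ∞ = ℝ → Set

-- a < sup S  iff  a < K for some K ∈ S.
sup : (ℝ → Set) → ℝ∞
sup S a = ∃[ K ] S K × a <ᴿ K

-- a < inf u  iff  some b > a satisfies b < u i for all i; asking only
-- a < u i for all i would wrongly admit a = inf u.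
inf : {I : Set} → (I → ℝ∞) → ℝ∞
inf u a = ∃[ b ] a <ᴿ b × (∀ i → u i b)

infix 4 _≤∞_

_≤∞_ : ℝ → ℝ∞ → Set
r ≤∞ u = ∀ a → a <ᴿ r → u a

record Graph : Set₁ where
  field
    V      : Set
    Adj    : V → V → Set
    symm   : ∀ {x y} → Adj x y → Adj y x
    irrefl : ∀ {x} → ¬ Adj x x

open Graph public

record LocallyFinite (G : Graph) : Set where
  field
    nbrs        : V G → List (V G)
    nbrs-unique : ∀ x → Unique (nbrs x)
    ∈-nbrs      : ∀ {x y} → y ∈ nbrs x ⇔ Adj G x y

open LocallyFinite public

degree : {G : Graph} → LocallyFinite G → V G → ℕ
degree lf x = length (nbrs lf x)

IsMinDegree : {G : Graph} → LocallyFinite G → ℕ → Set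
IsMinDegree lf δ = (∃[ x ] degree lf x ≡ δ) × (∀ x → δ ℕ.≤ degree lf x)

Connected : Graph → Set
Connected G = ∀ x y → Star (Adj G) x y

Edge : Graph → Set
Edge G = Σ (V G) λ u → Σ (V G) λ v → Adj G u v

-- The ordered triple (u , v , _) stands for the unordered edge {u, v}.
Joins : {G : Graph} → V G → V G → Edge G → Set
Joins x y (u , v , _) = (u ≡ x × v ≡ y) ⊎ (u ≡ y × v ≡ x)

infixl 6 _─_

_─_ : (G : Graph) → List (Edge G) → Graph
G ─ F = record
  { V      = V G
  ; Adj    = λ x y → Adj G x y × ¬ Any (Joins {G} x y) F
  ; symm   = λ (xy , xy∉F) → symm G xy , xy∉F ∘ Any.map swap
  ; irrefl = λ (xx , _) → irrefl G xx
  }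

-- A set of fewer than l edges is the same as the set of entries of a list
-- of length less than l (repetitions only make the set smaller).  The second
-- component encodes that a single vertex has edge-connectivity 0.
EdgeConnected : Graph → ℕ → Set
EdgeConnected G l =
  ((∃₂ λ (x y : V G) → x ≢ y) → ∀ F → length F ℕ.< l → Connected (G ─ F)) ×
  ((∀ (x y : V G) → x ≡ y) → l ≡ 0)

module _ {G : Graph} (lf : LocallyFinite G) where

  Δ : (V G → ℝ) → V G → ℝ
  Δ f x = sumᴿ (map (λ y → f y -ᴿ f x) (nbrs lf x))

  Γ : (V G → ℝ) → (V G → ℝ) → V G → ℝ
  Γ f g x = ½ᴿ *ᴿ (Δ (λ y → f y *ᴿ g y) x -ᴿ Δ f x *ᴿ g x -ᴿ f x *ᴿ Δ g x)

  Γ₂ : (V G → ℝ) → (V G → ℝ) → V G → ℝ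
  Γ₂ f g x = ½ᴿ *ᴿ (Δ (Γ f g) x -ᴿ Γ (Δ f) g x -ᴿ Γ f (Δ g) x)

  CD∞ : ℝ → V G → Set
  CD∞ K x = ∀ f → K *ᴿ Γ f f x ≤ᴿ Γ₂ f f x

  K-BE-at : V G → ℝ∞
  K-BE-at x = sup (λ K → CD∞ K x)

  K-BE : ℝ∞
  K-BE = inf K-BE-at

{-# OPTIONS --safe #-}
module Submission where

-- Suppose that deleting a set F of at most δ - 2 edges disconnects the graph.
-- The vertices still reachable from some u form a set P, and every edge
-- between P and its complement (a "cut edge") lies in F.  So there is a cut
-- with k ≤ δ - 2 edges, that is, every degree is at least k + 2.  Such a cut
-- is refuted by evaluating Γ₂(f) at one end x of a cut edge, for a test
-- function f that is constant on a few classes of vertices.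
--
-- For f x = 0 one has (4Γ₂ᶻ-Σ)
--   4 Γ₂(f)(x) = Σ_{y~x} Σ_{z~y} ((f z - 2 f y)² - (f y)²)
--                - deg x · Σ_{y~x} (f y)² + 2 (Σ_{y~x} f y)².
-- Apart from f x = 0, the test function takes the values -v and -s on the side
-- of x and n and 2n on the other side; the first value of each pair is for the
-- vertices incident with a cut edge, the second for the others.  Let a be the
-- number of cut edges at x, and let g and h be the numbers of neighbours of x
-- on its own side that are, respectively are not, incident with a cut edge.
-- Let A and σ be the numbers of cut edges at the neighbours of x on its own
-- side and across the cut.  Then (4Γ₂≤U) 4 Γ₂(f)(x) is at most a polynomial U
-- in these numbers.  The size k of the cut enters by a + A ≤ k, by σ ≤ k, and
-- by the bound that a neighbour w of x across the cut with b cut edges has at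
-- least 3 - a + σ - b neighbours across the cut that are not incident with a
-- cut edge (farB-count); each of these contributes -n².
--
-- If some vertex has more neighbours across the cut than on its own side,
-- moving it to the other side makes the cut smaller (Move), and induction on k
-- applies.  Otherwise put i = g + h, so that a ≤ i and k + 2 ≤ a + i.  The
-- choice n = i, v = s = 1 gives U < 0 whenever a ≥ 3.  Hence no vertex has
-- more than 2 cut edges.  If a = 2, the same choice works unless i ∈ {4, 5} and
-- a + A = k; in that case every vertex on the side of x with a cut edge is x or
-- a neighbour of x, and n = 6, v = 1, s = 3 works.  Hence no vertex has more
-- than one cut edge.  If a = 1, the choice n = i², v = s = 1 works.  So there
-- is no cut edge at all, although the graph is connected (no-cut).
--
-- All values of f are integers, so that Γ₂(f)(x) is a constant Cauchy sequence
-- with value in ¼ℤ, and the whole estimate takes place in ℤ.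

open import Defs
open import Algebra.Properties.AbelianGroup using (∙-cancelʳ)
open import Axiom.ExcludedMiddle using (ExcludedMiddle)
open import Data.Empty using (⊥; ⊥-elim)
open import Data.Integer hiding (_⊔_)
open import Data.Integer.Properties
open import Data.Integer.Tactic.RingSolver using (solve-∀)
open import Data.List as List using (List; []; _∷_; _++_; length; filter)
open import Data.List.Membership.Propositional using (_∈_; _∉_)
open import Data.List.Membership.Propositional.Properties using (∈-map⁺; ∈-filter⁺; ∈-++⁺ˡ; ∈-++⁺ʳ)
open import Data.List.Properties using (length-map; length-++)
open import Data.List.Relation.Unary.All as All using (All)
open import Data.List.Relation.Unary.AllPairs using ([]; _∷_)
open import Data.List.Relation.Unary.Any as Any using (Any; here; there)
import Data.List.Relation.Unary.Any.Properties as Any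
open import Data.List.Relation.Unary.Unique.Propositional using (Unique)
open import Data.Nat using (ℕ; _∸_)
import Data.Nat as ℕ
open import Data.Nat.Induction using (<-wellFounded)
import Data.Nat.Properties as ℕ
open import Data.Product using (_×_; _,_; ∃-syntax; ∃₂; proj₁; proj₂; swap)
open import Data.Rational as ℚ using (ℚ; 0ℚ; 1ℚ; ½)
open import Data.Rational.Literals using (fromℤ)
import Data.Rational.Properties as ℚ
open import Data.Rational.Solver using (module +-*-Solver)
import Data.Rational.Unnormalised as ℚᵘ
import Data.Rational.Unnormalised.Properties as ℚᵘ
open import Data.Sum using (_⊎_; inj₁; inj₂)
open import Function using (_∘_)
open import Function.Bundles using (Equivalence)
open import Induction.WellFounded using (Acc; acc)
open import Level using (0ℓ)
open import Relation.Binary.Construct.Closure.ReflexiveTransitive using (Star; ε; _◅_; _◅◅_)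
open import Relation.Binary.PropositionalEquality
open import Relation.Nullary using (Dec; yes; no; ¬_; contradiction)
open import Relation.Nullary.Decidable using (decidable-stable)

-- Order in ℤ

negative-absurd : ∀ {i} r → 0ℤ ≤ r → i ≡ - (1ℤ + r) → ¬ (0ℤ ≤ i)
negative-absurd {i} r 0≤r i≡ 0≤i with subst (0ℤ ≤_) (trans (cong (λ t → t + r) i≡) (ring r)) (+-mono-≤ 0≤i 0≤r)
  where
  ring : ∀ r → - (1ℤ + r) + r ≡ -1ℤ
  ring = solve-∀
... | ()

-- Inequalities are proved by exhibiting the difference as a sum of products of
-- nonnegative terms; the remaining equation is left to the ring solver.
≤-by : ∀ {i j} d → 0ℤ ≤ d → j ≡ i + d → i ≤ j
≤-by {i} d 0≤d j≡i+d = subst (i ≤_) (sym j≡i+d)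
  (subst (_≤ i + d) (+-identityʳ i) (+-monoʳ-≤ i 0≤d))

+-nonneg : ∀ {i j} → 0ℤ ≤ i → 0ℤ ≤ j → 0ℤ ≤ i + j
+-nonneg = +-mono-≤

*-nonneg : ∀ {i j} → 0ℤ ≤ i → 0ℤ ≤ j → 0ℤ ≤ i * j
*-nonneg {i} {j} 0≤i 0≤j = subst (_≤ i * j) (*-zeroʳ i)
  (*-monoˡ-≤-nonNeg i {{nonNegative 0≤i}} 0≤j)

sq-nonneg : ∀ i → 0ℤ ≤ i * i
sq-nonneg (+ n)      = *-nonneg {+ n} {+ n} (+≤+ ℕ.z≤n) (+≤+ ℕ.z≤n)
sq-nonneg (-[1+ n ]) = +≤+ ℕ.z≤n

gap : ∀ {i j} → i ≤ j → 0ℤ ≤ j - i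
gap = i≤j⇒0≤j-i

-- From real to integral curvature expressions

-- The sum of h over a list, with repetitions.
Σ : {A : Set} → List A → (A → ℤ) → ℤ
Σ []      h = 0ℤ
Σ (x ∷ l) h = h x + Σ l h

fromℤ-+ : ∀ i j → fromℤ (i + j) ≡ fromℤ i ℚ.+ fromℤ j
fromℤ-+ i j = ℚ.toℚᵘ-injective (ℚᵘ.≃-trans (ℚᵘ.*≡* (clear i j))
  (ℚᵘ.≃-sym (ℚ.toℚᵘ-homo-+ (fromℤ i) (fromℤ j))))
  where
  clear : ∀ i j → (i + j) * + 1 ≡ (i * + 1 + j * + 1) * + 1
  clear = solve-∀

fromℤ-* : ∀ i j → fromℤ (i * j) ≡ fromℤ i ℚ.* fromℤ j
fromℤ-* i j = ℚ.toℚᵘ-injective (ℚᵘ.≃-sym (ℚ.toℚᵘ-homo-* (fromℤ i) (fromℤ j)))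

fromℤ-neg : ∀ i → fromℤ (- i) ≡ ℚ.- fromℤ i
fromℤ-neg (+ 0)       = refl
fromℤ-neg (+[1+ n ]) = refl
fromℤ-neg (-[1+ n ]) = refl

-- q is c times the integer i.  The factors ½ in Γ and Γ₂ are collected in c.
infix 4 _≈[_]_
_≈[_]_ : ℚ → ℚ → ℤ → Set
q ≈[ c ] i = q ≡ c ℚ.* fromℤ i

module _ (c : ℚ) where

  ≈-+ : ∀ q r i j → q ≈[ c ] i → r ≈[ c ] j → q ℚ.+ r ≈[ c ] i + j
  ≈-+ q r i j p p′ = trans (cong₂ ℚ._+_ p p′)
    (trans (sym (ℚ.*-distribˡ-+ c (fromℤ i) (fromℤ j)))
           (cong (c ℚ.*_) (sym (fromℤ-+ i j))))

  ≈-− : ∀ q r i j → q ≈[ c ] i → r ≈[ c ] j → q ℚ.- r ≈[ c ] i - j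
  ≈-− q r i j p p′ = ≈-+ q (ℚ.- r) i (- j) p (trans (cong ℚ.-_ p′)
    (trans (ℚ.neg-distribʳ-* c (fromℤ j)) (cong (c ℚ.*_) (sym (fromℤ-neg j)))))

  ≈-* : ∀ d q r i j → q ≈[ c ] i → r ≈[ d ] j → q ℚ.* r ≈[ c ℚ.* d ] i * j
  ≈-* d q r i j p p′ = trans (cong₂ ℚ._*_ p p′)
    (trans (exchange c (fromℤ i) d (fromℤ j)) (cong (c ℚ.* d ℚ.*_) (sym (fromℤ-* i j))))
    where
    open +-*-Solver
    exchange : ∀ c x d y → (c ℚ.* x) ℚ.* (d ℚ.* y) ≡ (c ℚ.* d) ℚ.* (x ℚ.* y)
    exchange = solve 4 (λ c x d y → (c :* x) :* (d :* y) := (c :* d) :* (x :* y)) refl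

  ≈-½ : ∀ q i → q ≈[ c ] i → ½ ℚ.* q ≈[ ½ ℚ.* c ] i
  ≈-½ q i p = trans (cong (½ ℚ.*_) p) (sym (ℚ.*-assoc ½ c (fromℤ i)))

  ≈-sum : {A : Set} (n : ℕ) (h : A → ℝ) (h′ : A → ℤ) → (∀ y → seq (h y) n ≈[ c ] h′ y) →
    ∀ l → seq (sumᴿ (List.map h l)) n ≈[ c ] Σ l h′
  ≈-sum n h h′ p []      = sym (ℚ.*-zeroʳ c)
  ≈-sum n h h′ p (y ∷ l) = ≈-+ _ _ (h′ y) (Σ l h′) (p y) (≈-sum n h h′ p l)

module _ {G : Graph} (lf : LocallyFinite G) where

  -- Integral versions of Δ, 2Γ and 4Γ₂ for integer-valued functions.
  --
  -- The graph is passed explicitly to nbrs, Δ, Γ and so on: an inferred graph is an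
  -- eta-expanded copy of G, and comparing it with G unfolds the Cauchy proofs.
  Δᶻ : (V G → ℤ) → V G → ℤ
  Δᶻ f x = Σ (nbrs {G} lf x) (λ y → f y - f x)

  2Γᶻ : (V G → ℤ) → (V G → ℤ) → V G → ℤ
  2Γᶻ f g x = Δᶻ (λ y → f y * g y) x - Δᶻ f x * g x - f x * Δᶻ g x

  4Γ₂ᶻ : (V G → ℤ) → V G → ℤ
  4Γ₂ᶻ f x = Δᶻ (2Γᶻ f f) x - 2Γᶻ (Δᶻ f) f x - 2Γᶻ f (Δᶻ f) x

  module _ (n : ℕ) where

    -- The n-th terms of the Cauchy sequences of Δ, Γ and Γ₂.
    ≈-Δ : ∀ c (f : V G → ℝ) (f′ : V G → ℤ) → (∀ y → seq (f y) n ≈[ c ] f′ y) →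
      ∀ x → seq (Δ {G} lf f x) n ≈[ c ] Δᶻ f′ x
    ≈-Δ c f f′ p x = ≈-sum c n (λ y → f y -ᴿ f x) (λ y → f′ y - f′ x)
      (λ y → ≈-− c (seq (f y) n) (seq (f x) n) (f′ y) (f′ x) (p y) (p x)) (nbrs {G} lf x)

    ≈-Γ : ∀ c d (f g : V G → ℝ) (f′ g′ : V G → ℤ) →
      (∀ y → seq (f y) n ≈[ c ] f′ y) → (∀ y → seq (g y) n ≈[ d ] g′ y) →
      ∀ x → seq (Γ {G} lf f g x) n ≈[ ½ ℚ.* (c ℚ.* d) ] 2Γᶻ f′ g′ x
    ≈-Γ c d f g f′ g′ p q x =
      ≈-½ (c ℚ.* d) _ _ (≈-− (c ℚ.* d) _ _ _ _ (≈-− (c ℚ.* d) _ _ _ _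
        (≈-Δ (c ℚ.* d) (λ y → f y *ᴿ g y) (λ y → f′ y * g′ y)
          (λ y → ≈-* c d (seq (f y) n) (seq (g y) n) (f′ y) (g′ y) (p y) (q y)) x)
        (≈-* c d _ _ _ _ (≈-Δ c f f′ p x) (q x)))
        (≈-* c d _ _ _ _ (p x) (≈-Δ d g g′ q x)))

    ≈-Γ₂ : ∀ c (f : V G → ℝ) (f′ : V G → ℤ) → (∀ y → seq (f y) n ≈[ c ] f′ y) →
      ∀ x → seq (Γ₂ {G} lf f f x) n ≈[ ½ ℚ.* (½ ℚ.* (c ℚ.* c)) ] 4Γ₂ᶻ f′ x
    ≈-Γ₂ c f f′ p x = ≈-½ d _ _ (≈-− d _ _ _ _ (≈-− d _ _ _ _
        (≈-Δ d (Γ {G} lf f f) (2Γᶻ f′ f′) (≈-Γ c c f f f′ f′ p p) x)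
        (≈-Γ c c (Δ {G} lf f) f (Δᶻ f′) f′ (≈-Δ c f f′ p) p x))
        (≈-Γ c c f (Δ {G} lf f) f′ (Δᶻ f′) p (≈-Δ c f f′ p) x))
      where
      d : ℚ
      d = ½ ℚ.* (c ℚ.* c)

  -- CD(∞, K) is only known at x for reals K arbitrarily close to 0 from below.  If
  -- Γ₂ were the constant q < 0, then K > -κ with κ = -q / (g + 1) would give
  -- q = -κ g - κ < K g, against CD(∞, K).
  Γ₂-nonneg : 0ᴿ ≤∞ K-BE {G} lf → ∀ F x {q g} →
    (∀ n → seq (Γ₂ {G} lf F F x) n ≡ q) → (∀ n → seq (Γ {G} lf F F x) n ≡ g) → 0ℚ ℚ.≤ g → 0ℚ ℚ.≤ q
  Γ₂-nonneg K≥0 F x {q} {g} Γ₂≡q Γ≡g g≥0 = ℚ.≮⇒≥ λ q<0 →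
    let instance
          D-pos : ℚ.Positive (g ℚ.+ 1ℚ)
          D-pos = ℚ.positive (ℚ.+-mono-≤-< g≥0 (ℚ.positive⁻¹ 1ℚ))
          D≢0 : ℚ.NonZero (g ℚ.+ 1ℚ)
          D≢0 = ℚ.pos⇒nonZero (g ℚ.+ 1ℚ)
          D⁻¹-pos : ℚ.Positive (ℚ.1/ (g ℚ.+ 1ℚ))
          D⁻¹-pos = ℚ.1/pos⇒pos (g ℚ.+ 1ℚ)
        κ    = ℚ.1/ (g ℚ.+ 1ℚ) ℚ.* ℚ.- q
        κ>0 : 0ℚ ℚ.< κ
        κ>0  = subst (ℚ._< κ) (ℚ.*-zeroʳ (ℚ.1/ (g ℚ.+ 1ℚ)))
                 (ℚ.*-monoʳ-<-pos (ℚ.1/ (g ℚ.+ 1ℚ)) (ℚ.neg-antimono-< q<0))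
        κD : (g ℚ.+ 1ℚ) ℚ.* κ ≡ ℚ.- q
        κD   = trans (sym (ℚ.*-assoc (g ℚ.+ 1ℚ) _ _))
                 (trans (cong (ℚ._* ℚ.- q) (ℚ.*-inverseʳ (g ℚ.+ 1ℚ))) (ℚ.*-identityˡ _))
        η    = ½ ℚ.* κ
        η>0 : 0ℚ ℚ.< η
        η>0  = ℚ.*-monoʳ-<-pos ½ κ>0
        η<   : ∀ a → a ℚ.- κ ℚ.+ η ℚ.< a
        η< a = subst₂ ℚ._<_ (half a κ) (ℚ.+-identityʳ a)
                 (ℚ.+-monoʳ-< a (ℚ.neg-antimono-< η>0))
        (b , (e , e>0 , N , a<b) , b<sup) = K≥0 (fromℚ (ℚ.- κ)) (η , η>0 , 0 , λ _ _ →
          subst (λ t → t ℚ.+ η ℚ.< 0ℚ) (ℚ.+-identityˡ (ℚ.- κ)) (η< 0ℚ))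
        (K , CD , (e′ , e′>0 , N′ , b<K)) = b<sup x
    in CD F (η , η>0 , N ℕ.⊔ N′ , λ n n≥ →
         let b>-κ : ℚ.- κ ℚ.< seq b n
             b>-κ = <-drop e>0 (a<b n (ℕ.m⊔n≤o⇒m≤o N N′ n≥))
             K>-κ : ℚ.- κ ℚ.< seq K n
             K>-κ = ℚ.<-trans b>-κ (<-drop e′>0 (b<K n (ℕ.m⊔n≤o⇒n≤o N N′ n≥)))
         in subst₂ (λ s t → s ℚ.+ η ℚ.< seq K n ℚ.* t) (sym (Γ₂≡q n)) (sym (Γ≡g n))
              (ℚ.<-≤-trans
                (subst (λ t → t ℚ.+ η ℚ.< ℚ.- κ ℚ.* g) (sym (q≡ κ κD)) (η< (ℚ.- κ ℚ.* g)))
                (ℚ.*-monoʳ-≤-nonNeg g {{ℚ.nonNegative g≥0}} (ℚ.<⇒≤ K>-κ))))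
    where
    open +-*-Solver
    <-drop : ∀ {e u w} → 0ℚ ℚ.< e → u ℚ.+ e ℚ.< w → u ℚ.< w
    <-drop {e} {u} e>0 = ℚ.<-trans (subst (ℚ._< u ℚ.+ e) (ℚ.+-identityʳ u) (ℚ.+-monoʳ-< u e>0))
    half : ∀ a κ → a ℚ.- ½ ℚ.* κ ≡ a ℚ.- κ ℚ.+ ½ ℚ.* κ
    half = solve 2 (λ a κ → a :- con ½ :* κ := a :- κ :+ con ½ :* κ) refl
    q≡ : ∀ κ → (g ℚ.+ 1ℚ) ℚ.* κ ≡ ℚ.- q → q ≡ ℚ.- κ ℚ.* g ℚ.- κ
    q≡ κ eq = trans (neg-neg q) (trans (cong ℚ.-_ (sym eq)) (expand g κ))
      where
      neg-neg : ∀ q → q ≡ ℚ.- (ℚ.- q)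
      neg-neg = solve 1 (λ q → q := :- (:- q)) refl
      expand : ∀ g κ → ℚ.- ((g ℚ.+ 1ℚ) ℚ.* κ) ≡ ℚ.- κ ℚ.* g ℚ.- κ
      expand = solve 2 (λ g κ → :- ((g :+ con 1ℚ) :* κ) := (:- κ) :* g :- κ) refl

  4Γ₂ᶻ-nonneg : 0ᴿ ≤∞ K-BE {G} lf → ∀ f x → 0ℤ ≤ 2Γᶻ f f x → 0ℤ ≤ 4Γ₂ᶻ f x
  4Γ₂ᶻ-nonneg K≥0 f x Γ≥0 = scale⁻¹ (Γ₂-nonneg K≥0 F x
    (λ n → ≈-Γ₂ n 1ℚ F f p x) (λ n → ≈-Γ n 1ℚ 1ℚ F F f f p p x) (scale Γ≥0))
    where
    F : V G → ℝ
    F y = fromℚ (fromℤ (f y))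
    p : ∀ y → fromℤ (f y) ≈[ 1ℚ ] f y
    p y = sym (ℚ.*-identityˡ (fromℤ (f y)))
    scale : ∀ {i} → 0ℤ ≤ i → 0ℚ ℚ.≤ ½ ℚ.* (1ℚ ℚ.* 1ℚ) ℚ.* fromℤ i
    scale {+ n} _ = ℚ.nonNegative⁻¹ _
      {{ℚ.nonNeg*nonNeg⇒nonNeg (½ ℚ.* (1ℚ ℚ.* 1ℚ)) (fromℤ (+ n))}}
    scale⁻¹ : ∀ {i} → 0ℚ ℚ.≤ ½ ℚ.* (½ ℚ.* (1ℚ ℚ.* 1ℚ)) ℚ.* fromℤ i → 0ℤ ≤ i
    scale⁻¹ {i} ¼i≥0 = subst (0ℤ ≤_) (*-identityʳ i) (ℚ.drop-*≤* fromℤ-i≥0)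
      where
      c : ℚ
      c = ½ ℚ.* (½ ℚ.* (1ℚ ℚ.* 1ℚ))
      fromℤ-i≥0 : 0ℚ ℚ.≤ fromℤ i
      fromℤ-i≥0 = ℚ.*-cancelˡ-≤-pos {0ℚ} {fromℤ i} c ¼i≥0

-- Finite sums and double counting

module _ {A : Set} where

  Σ-mono : ∀ (l : List A) {f g : A → ℤ} → (∀ {y} → y ∈ l → f y ≤ g y) → Σ l f ≤ Σ l g
  Σ-mono []      f≤g = ≤-refl
  Σ-mono (x ∷ l) f≤g = +-mono-≤ (f≤g (here refl)) (Σ-mono l (f≤g ∘ there))

  Σ-cong : ∀ (l : List A) {f g : A → ℤ} → (∀ {y} → y ∈ l → f y ≡ g y) → Σ l f ≡ Σ l g
  Σ-cong []      f≡g = refl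
  Σ-cong (x ∷ l) f≡g = cong₂ _+_ (f≡g (here refl)) (Σ-cong l (f≡g ∘ there))

  Σ-+ : ∀ (l : List A) (f g : A → ℤ) → Σ l (λ y → f y + g y) ≡ Σ l f + Σ l g
  Σ-+ []      f g = refl
  Σ-+ (x ∷ l) f g = trans (cong (λ t → f x + g x + t) (Σ-+ l f g)) (interchange (f x) (g x) (Σ l f) (Σ l g))
    where
    interchange : ∀ a b c d → a + b + (c + d) ≡ a + c + (b + d)
    interchange = solve-∀

  Σ-* : ∀ (l : List A) (c : ℤ) (f : A → ℤ) → Σ l (λ y → c * f y) ≡ c * Σ l f
  Σ-* []      c f = sym (*-zeroʳ c)
  Σ-* (x ∷ l) c f = trans (cong (λ t → c * f x + t) (Σ-* l c f)) (sym (*-distribˡ-+ c (f x) (Σ l f)))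

  Σ-zero : ∀ (l : List A) → Σ l (λ _ → 0ℤ) ≡ 0ℤ
  Σ-zero []      = refl
  Σ-zero (x ∷ l) = trans (+-identityˡ _) (Σ-zero l)

  Σ-nonneg : ∀ (l : List A) {f : A → ℤ} → (∀ {y} → y ∈ l → 0ℤ ≤ f y) → 0ℤ ≤ Σ l f
  Σ-nonneg l {f} f≥0 = subst (_≤ Σ l f) (Σ-zero l) (Σ-mono l f≥0)

  -- A nonnegative sum is at least each of its terms.
  Σ-∈ : ∀ {l : List A} {f : A → ℤ} {y} → (∀ {y} → y ∈ l → 0ℤ ≤ f y) → y ∈ l → f y ≤ Σ l f
  Σ-∈ {x ∷ l} {f} f≥0 (here refl) =
    subst (_≤ f x + Σ l f) (+-identityʳ (f x)) (+-monoʳ-≤ (f x) (Σ-nonneg l (f≥0 ∘ there)))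
  Σ-∈ {x ∷ l} {f} f≥0 (there y∈l) =
    subst (_≤ f x + Σ l f) (+-identityˡ _) (+-mono-≤ (f≥0 (here refl)) (Σ-∈ (f≥0 ∘ there) y∈l))

  Σ-1 : ∀ (l : List A) → Σ l (λ _ → 1ℤ) ≡ + length l
  Σ-1 []      = refl
  Σ-1 (x ∷ l) = cong (_+_ 1ℤ) (Σ-1 l)

Σ-linear₂ : ∀ {A : Set} (l : List A) c d (f g : A → ℤ) →
  Σ l (λ y → c * f y + d * g y) ≡ c * Σ l f + d * Σ l g
Σ-linear₂ l c d f g = trans (Σ-+ l (λ y → c * f y) (λ y → d * g y)) (cong₂ _+_ (Σ-* l c f) (Σ-* l d g))

Σ-linear₃ : ∀ {A : Set} (l : List A) b c d (e f g : A → ℤ) →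
  Σ l (λ y → b * e y + c * f y + d * g y) ≡ b * Σ l e + c * Σ l f + d * Σ l g
Σ-linear₃ l b c d e f g = trans (Σ-+ l (λ y → b * e y + c * f y) (λ y → d * g y))
  (cong₂ _+_ (Σ-linear₂ l b c e f) (Σ-* l d g))

Σ-swap : ∀ {A B : Set} (l : List A) (m : List B) (f : A → B → ℤ) →
  Σ l (λ x → Σ m (f x)) ≡ Σ m (λ y → Σ l (λ x → f x y))
Σ-swap []      m f = sym (Σ-zero m)
Σ-swap (x ∷ l) m f = trans (cong (λ t → Σ m (f x) + t) (Σ-swap l m f)) (sym (Σ-+ m (f x) _))

-- Indicators of arbitrary propositions, by excluded middle.
module Indicator (em : ExcludedMiddle 0ℓ) where

  ind : {P : Set} → Dec P → ℤ
  ind (yes _) = 1ℤ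
  ind (no  _) = 0ℤ

  ⟦_⟧ : Set → ℤ
  ⟦ P ⟧ = ind (em {P})

  ⟦⟧-yes : ∀ {P} → P → ⟦ P ⟧ ≡ 1ℤ
  ⟦⟧-yes {P} p with em {P}
  ... | yes _ = refl
  ... | no ¬p = contradiction p ¬p

  ⟦⟧-no : ∀ {P} → ¬ P → ⟦ P ⟧ ≡ 0ℤ
  ⟦⟧-no {P} ¬p with em {P}
  ... | yes p = contradiction p ¬p
  ... | no _  = refl

  0≤⟦⟧ : ∀ P → 0ℤ ≤ ⟦ P ⟧
  0≤⟦⟧ P with em {P}
  ... | yes _ = +≤+ ℕ.z≤n
  ... | no _  = +≤+ ℕ.z≤n

  ⟦⟧≤1 : ∀ P → ⟦ P ⟧ ≤ 1ℤ
  ⟦⟧≤1 P with em {P}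
  ... | yes _ = ≤-refl
  ... | no _  = +≤+ ℕ.z≤n

  module _ {A : Set} where

    Σ-≡-∉ : ∀ {c : A} {l} → c ∉ l → Σ l (λ y → ⟦ c ≡ y ⟧) ≡ 0ℤ
    Σ-≡-∉ {c} {l} c∉l = trans (Σ-cong l (λ y∈l → ⟦⟧-no λ c≡y → c∉l (subst (_∈ l) (sym c≡y) y∈l))) (Σ-zero l)

    Σ-≡-unique : ∀ {c : A} {l} → Unique l → Σ l (λ y → ⟦ c ≡ y ⟧) ≤ 1ℤ
    Σ-≡-unique {c} {[]}    []        = +≤+ ℕ.z≤n
    Σ-≡-unique {c} {x ∷ l} (x∉l ∷ u) with em {c ≡ x}
    ... | no _     = subst (_≤ 1ℤ) (sym (+-identityˡ _)) (Σ-≡-unique u)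
    ... | yes refl = ≤-reflexive (cong (λ t → 1ℤ + t) (Σ-≡-∉ {c} {l} λ c∈l → All.lookup x∉l c∈l refl))

    Σ-≡-∈ : ∀ {c : A} {l} → c ∈ l → 1ℤ ≤ Σ l (λ y → ⟦ c ≡ y ⟧)
    Σ-≡-∈ {c} {l} c∈l = subst (_≤ Σ l (λ y → ⟦ c ≡ y ⟧)) (⟦⟧-yes refl)
      (Σ-∈ {f = λ y → ⟦ c ≡ y ⟧} (λ _ → 0≤⟦⟧ _) c∈l)

    -- Terms of l that occur in l′ sum to at most the sum over l′, when l has no
    -- repetitions and g is nonnegative.
    Σ-⊆ : ∀ {l l′ : List A} → Unique l → (g : A → ℤ) → (∀ y → 0ℤ ≤ g y) →
      Σ l (λ y → g y * ⟦ y ∈ l′ ⟧) ≤ Σ l′ g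
    Σ-⊆ {l} {l′} u g g≥0 = ≤-trans (Σ-mono l (λ {y} _ → pointwise y)) (≤-trans
      (≤-reflexive (Σ-swap l l′ (λ y z → g z * ⟦ z ≡ y ⟧)))
      (Σ-mono l′ λ {z} _ → ≤-trans (≤-reflexive (Σ-* l (g z) (λ y → ⟦ z ≡ y ⟧)))
        (subst (g z * Σ l (λ y → ⟦ z ≡ y ⟧) ≤_) (*-identityʳ (g z))
          (*-monoˡ-≤-nonNeg (g z) {{nonNegative (g≥0 z)}} (Σ-≡-unique u)))))
      where
      nonneg : ∀ y z → 0ℤ ≤ g z * ⟦ z ≡ y ⟧
      nonneg y z = *-nonneg (g≥0 z) (0≤⟦⟧ (z ≡ y))
      pointwise : ∀ y → g y * ⟦ y ∈ l′ ⟧ ≤ Σ l′ (λ z → g z * ⟦ z ≡ y ⟧)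
      pointwise y with em {y ∈ l′}
      ... | no _     = subst (_≤ Σ l′ (λ z → g z * ⟦ z ≡ y ⟧)) (sym (*-zeroʳ (g y)))
                         (Σ-nonneg l′ (λ {z} _ → nonneg y z))
      ... | yes y∈l′ = subst (_≤ Σ l′ (λ z → g z * ⟦ z ≡ y ⟧)) (cong (g y *_) (⟦⟧-yes {y ≡ y} refl))
                         (Σ-∈ {f = λ z → g z * ⟦ z ≡ y ⟧} (λ {z} _ → nonneg y z) y∈l′)

    module _ {E : Set} (C : List E) where

      -- The length of C as an integer.
      size : ℤ
      size = Σ C (λ _ → 1ℤ)

      -- The number of entries of C whose image under p is y.  With C a list of cut
      -- edges and p a projection, this bounds the number of cut edges at y.
      fibre : (E → A) → A → ℤ
      fibre p y = Σ C (λ e → ⟦ p e ≡ y ⟧)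

      fibre≥0 : ∀ p y → 0ℤ ≤ fibre p y
      fibre≥0 p y = Σ-nonneg C (λ _ → 0≤⟦⟧ _)

      -- The fibres over distinct points are disjoint.
      Σ-fibre : ∀ p {l} → Unique l → Σ l (fibre p) ≤ size
      Σ-fibre p {l} u = ≤-trans (≤-reflexive (Σ-swap l C (λ y e → ⟦ p e ≡ y ⟧)))
        (Σ-mono C (λ _ → Σ-≡-unique u))

      -- The same for l followed by l′, where the points of l that occur in l′ are
      -- discarded.
      Σ-fibre₂ : ∀ p {l l′} → Unique l → Unique l′ →
        Σ l (λ y → fibre p y * ⟦ y ∉ l′ ⟧) + Σ l′ (fibre p) ≤ size
      Σ-fibre₂ p {l} {l′} u u′ = ≤-trans (≤-reflexive (cong₂ _+_
          (trans (Σ-cong l (λ {y} _ → trans (*-comm (fibre p y) _) (sym (Σ-* C ⟦ y ∉ l′ ⟧ (λ e → ⟦ p e ≡ y ⟧)))))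
            (Σ-swap l C (λ y e → ⟦ y ∉ l′ ⟧ * ⟦ p e ≡ y ⟧)))
          (Σ-swap l′ C (λ y e → ⟦ p e ≡ y ⟧))))
        (≤-trans (≤-reflexive (sym (Σ-+ C _ _))) (Σ-mono C (λ {e} _ → pointwise (p e))))
        where
        pointwise : ∀ c → Σ l (λ y → ⟦ y ∉ l′ ⟧ * ⟦ c ≡ y ⟧) + Σ l′ (λ y → ⟦ c ≡ y ⟧) ≤ 1ℤ
        pointwise c with em {c ∈ l′}
        ... | yes c∈l′ = subst (λ t → t + Σ l′ (λ y → ⟦ c ≡ y ⟧) ≤ 1ℤ)
              (sym (trans (Σ-cong l (λ {y} _ → vanish y)) (Σ-zero l)))
              (subst (_≤ 1ℤ) (sym (+-identityˡ _)) (Σ-≡-unique u′))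
          where
          vanish : ∀ y → ⟦ y ∉ l′ ⟧ * ⟦ c ≡ y ⟧ ≡ 0ℤ
          vanish y with em {c ≡ y}
          ... | no _     = *-zeroʳ ⟦ y ∉ l′ ⟧
          ... | yes refl = cong (_* 1ℤ) (⟦⟧-no {y ∉ l′} (λ y∉ → y∉ c∈l′))
        ... | no c∉l′ = subst (λ t → Σ l (λ y → ⟦ y ∉ l′ ⟧ * ⟦ c ≡ y ⟧) + t ≤ 1ℤ) (sym (Σ-≡-∉ c∉l′))
              (subst (_≤ 1ℤ) (sym (+-identityʳ _))
                (≤-trans (Σ-mono l (λ {y} _ → drop y)) (Σ-≡-unique u)))
          where
          drop : ∀ y → ⟦ y ∉ l′ ⟧ * ⟦ c ≡ y ⟧ ≤ ⟦ c ≡ y ⟧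
          drop y = subst (⟦ y ∉ l′ ⟧ * ⟦ c ≡ y ⟧ ≤_) (*-identityˡ _)
            (*-monoʳ-≤-nonNeg ⟦ c ≡ y ⟧ {{nonNegative (0≤⟦⟧ (c ≡ y))}} (⟦⟧≤1 (y ∉ l′)))

      -- If w z is at most the number of entries with images y and z, then the sum of
      -- w over distinct z is at most the size of the fibre over y.
      Σ≤fibre : ∀ (p q : E → A) y {l} → Unique l → (w : A → ℤ) →
        (∀ {z} → z ∈ l → w z ≤ Σ C (λ e → ⟦ p e ≡ y ⟧ * ⟦ q e ≡ z ⟧)) → Σ l w ≤ fibre p y
      Σ≤fibre p q y {l} u w w≤ = ≤-trans (Σ-mono l w≤) (≤-trans
        (≤-reflexive (Σ-swap l C (λ z e → ⟦ p e ≡ y ⟧ * ⟦ q e ≡ z ⟧)))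
        (Σ-mono C λ {e} _ → ≤-trans (≤-reflexive (Σ-* l ⟦ p e ≡ y ⟧ (λ z → ⟦ q e ≡ z ⟧)))
          (subst (⟦ p e ≡ y ⟧ * Σ l (λ z → ⟦ q e ≡ z ⟧) ≤_) (*-identityʳ _)
            (*-monoˡ-≤-nonNeg ⟦ p e ≡ y ⟧ {{nonNegative (0≤⟦⟧ _)}} (Σ-≡-unique u)))))

      pairs≥0 : ∀ (p q : E → A) y z → 0ℤ ≤ Σ C (λ e → ⟦ p e ≡ y ⟧ * ⟦ q e ≡ z ⟧)
      pairs≥0 p q y z = Σ-nonneg C λ {e} _ → *-nonneg (0≤⟦⟧ (p e ≡ y)) (0≤⟦⟧ (q e ≡ z))

      ∈⇒1≤ : ∀ (p q : E → A) {e} → e ∈ C → 1ℤ ≤ Σ C (λ e′ → ⟦ p e′ ≡ p e ⟧ * ⟦ q e′ ≡ q e ⟧)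
      ∈⇒1≤ p q {e} e∈C = subst (_≤ Σ C (λ e′ → ⟦ p e′ ≡ p e ⟧ * ⟦ q e′ ≡ q e ⟧))
        (cong₂ _*_ (⟦⟧-yes {p e ≡ p e} refl) (⟦⟧-yes {q e ≡ q e} refl))
        (Σ-∈ {f = λ e′ → ⟦ p e′ ≡ p e ⟧ * ⟦ q e′ ≡ q e ⟧} (λ {e′} _ → *-nonneg (0≤⟦⟧ (p e′ ≡ p e)) (0≤⟦⟧ (q e′ ≡ q e))) e∈C)

-- The expression 4Γ₂ as a double sum

-- The contribution of a path from x over y to z to 4Γ₂(f)(x), for f y = b and
-- f z = a.
φ : ℤ → ℤ → ℤ
φ a b = (a - + 2 * b) * (a - + 2 * b) - b * b

module _ {A : Set} (f g : A → ℤ) (a b : ℤ) where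

  -- The next three lemmas expand the definitions of 2Γ, of the inner sum and of
  -- 4Γ₂ over an arbitrary list in place of the neighbours, by induction on it.
  Σ-Γ : ∀ l → Σ l (λ y → f y * g y - a * b) - Σ l (λ y → f y - a) * b - a * Σ l (λ y → g y - b)
    ≡ Σ l (λ y → (f y - a) * (g y - b))
  Σ-Γ []      = base a b
    where
    base : ∀ a b → 0ℤ - 0ℤ * b - a * 0ℤ ≡ 0ℤ
    base = solve-∀
  Σ-Γ (y ∷ l) = trans (step (f y) (g y) a b _ _ _) (cong (λ t → (f y - a) * (g y - b) + t) (Σ-Γ l))
    where
    step : ∀ u v a b S T R → (u * v - a * b + S) - (u - a + T) * b - a * (v - b + R)
      ≡ (u - a) * (v - b) + (S - T * b - a * R)
    step = solve-∀

Σ-φ : ∀ {A : Set} (f : A → ℤ) b l →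
  Σ l (λ z → φ (f z) b) ≡ Σ l (λ z → (f z - b) * (f z - b)) - + 2 * b * Σ l (λ z → f z - b)
Σ-φ f b []      = base b
  where
  base : ∀ b → 0ℤ ≡ 0ℤ - + 2 * b * 0ℤ
  base = solve-∀
Σ-φ f b (z ∷ l) = trans (cong (λ t → φ (f z) b + t) (Σ-φ f b l)) (step (f z) b _ _)
  where
  step : ∀ a b S T → ((a - + 2 * b) * (a - + 2 * b) - b * b) + (S - + 2 * b * T)
    ≡ ((a - b) * (a - b) + S) - + 2 * b * (a - b + T)
  step = solve-∀

Σ-Γ₂ : ∀ {A : Set} (γ D f : A → ℤ) γ₀ D₀ l →
  Σ l (λ y → γ y - γ₀) - Σ l (λ y → (D y - D₀) * (f y - 0ℤ)) - Σ l (λ y → (f y - 0ℤ) * (D y - D₀))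
  ≡ Σ l (λ y → γ y - + 2 * f y * D y) - Σ l (λ _ → 1ℤ) * γ₀ + + 2 * (D₀ * Σ l f)
Σ-Γ₂ γ D f γ₀ D₀ []      = base γ₀ D₀
  where
  base : ∀ γ₀ D₀ → 0ℤ ≡ 0ℤ - 0ℤ * γ₀ + + 2 * (D₀ * 0ℤ)
  base = solve-∀
Σ-Γ₂ γ D f γ₀ D₀ (y ∷ l) = trans (regroup (γ y) (D y) (f y) γ₀ D₀ _ _ _)
  (trans (cong (λ t → γ y - γ₀ - + 2 * ((D y - D₀) * f y) + t) (Σ-Γ₂ γ D f γ₀ D₀ l))
         (step (γ y) (D y) (f y) γ₀ D₀ _ (Σ l (λ _ → 1ℤ)) _))
  where
  regroup : ∀ g d u γ₀ D₀ S T R →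
    (g - γ₀ + S) - ((d - D₀) * (u - 0ℤ) + T) - ((u - 0ℤ) * (d - D₀) + R)
    ≡ g - γ₀ - + 2 * ((d - D₀) * u) + (S - T - R)
  regroup = solve-∀
  step : ∀ g d u γ₀ D₀ S T R →
    g - γ₀ - + 2 * ((d - D₀) * u) + (S - T * γ₀ + + 2 * (D₀ * R))
    ≡ g - + 2 * u * d + S - (1ℤ + T) * γ₀ + + 2 * (D₀ * (u + R))
  step = solve-∀

module _ {G : Graph} (lf : LocallyFinite G) where

  2Γᶻ-Σ : ∀ f g x → 2Γᶻ lf f g x ≡ Σ (nbrs {G} lf x) (λ y → (f y - f x) * (g y - g x))
  2Γᶻ-Σ f g x = Σ-Γ f g (f x) (g x) (nbrs {G} lf x)

  4Γ₂ᶻ-Σ : ∀ f x → f x ≡ 0ℤ → let N = nbrs {G} lf in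
    4Γ₂ᶻ lf f x ≡ Σ (N x) (λ y → Σ (N y) (λ z → φ (f z) (f y)))
      - Σ (N x) (λ _ → 1ℤ) * Σ (N x) (λ y → f y * f y) + + 2 * (Σ (N x) f * Σ (N x) f)
  4Γ₂ᶻ-Σ f x fx≡0 = trans
    (cong₂ (λ s t → Σ (N x) (λ y → 2Γᶻ lf f f y - 2Γᶻ lf f f x) - s - t)
      (trans (2Γᶻ-Σ (Δᶻ lf f) f x)
        (cong (λ t → Σ (N x) (λ y → (Δᶻ lf f y - Δᶻ lf f x) * (f y - t))) fx≡0))
      (trans (2Γᶻ-Σ f (Δᶻ lf f) x)
        (cong (λ t → Σ (N x) (λ y → (f y - t) * (Δᶻ lf f y - Δᶻ lf f x))) fx≡0)))
    (trans (Σ-Γ₂ (2Γᶻ lf f f) (Δᶻ lf f) f (2Γᶻ lf f f x) (Δᶻ lf f x) (N x))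
      (cong₂ _+_ (cong₂ (λ s t → s - Σ (N x) (λ _ → 1ℤ) * t) inner Γx)
        (cong (λ t → + 2 * (t * Σ (N x) f)) Δx)))
    where
    N = nbrs {G} lf
    Δx : Δᶻ lf f x ≡ Σ (N x) f
    Δx = Σ-cong (N x) (λ {y} _ → trans (cong (λ t → f y - t) fx≡0) (+-identityʳ (f y)))
    Γx : 2Γᶻ lf f f x ≡ Σ (N x) (λ y → f y * f y)
    Γx = trans (2Γᶻ-Σ f f x) (Σ-cong (N x) (λ {y} _ →
      trans (cong (λ t → (f y - t) * (f y - t)) fx≡0) (cong (λ t → t * t) (+-identityʳ (f y)))))
    inner : Σ (N x) (λ y → 2Γᶻ lf f f y - + 2 * f y * Δᶻ lf f y)
      ≡ Σ (N x) (λ y → Σ (N y) (λ z → φ (f z) (f y)))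
    inner = Σ-cong (N x) (λ {y} _ → trans
      (cong (λ t → t - + 2 * f y * Δᶻ lf f y) (2Γᶻ-Σ f f y)) (sym (Σ-φ f (f y) (N y))))

-- Counting around one end of a cut

-- A cut: P is one of its sides and C is a list of ordered pairs that contains
-- every cut edge, directed out of P.  Other entries and repetitions are harmless,
-- since only upper bounds by the length k of C are used.  The vertex x lies in P.
-- The side of x is called near, the other one far.
module Local (em : ExcludedMiddle 0ℓ) {G : Graph} (lf : LocallyFinite G)
  (P : V G → Set) (C : List (V G × V G))
  (cut : ∀ {u v} → P u → ¬ P v → Adj G u v → (u , v) ∈ C)
  (x : V G) (Px : P x) where

  open Indicator em

  N : V G → List (V G)
  N = nbrs {G} lf

  k : ℤ
  k = size {V G} C

  adjacent : ∀ {y z} → z ∈ N y → Adj G y z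
  adjacent = Equivalence.to (∈-nbrs {G} lf)

  neighbour : ∀ {y z} → Adj G y z → z ∈ N y
  neighbour = Equivalence.from (∈-nbrs {G} lf)

  -- The class of a vertex on which the value of the test function depends: x itself,
  -- and the near and far vertices that are (B, boundary) or are not (I, interior)
  -- incident with a cut edge.
  data View (z : V G) : Set where
    root  : z ≡ x → View z
    nearB : P z → z ≢ x → ∃[ v ] (¬ P v × Adj G z v) → View z
    nearI : P z → z ≢ x → ¬ (∃[ v ] (¬ P v × Adj G z v)) → View z
    farB  : ¬ P z → ∃[ u ] (P u × Adj G z u) → View z
    farI  : ¬ P z → ¬ (∃[ u ] (P u × Adj G z u)) → View z

  view : ∀ z → View z
  view z with em {P z} | em {z ≡ x} | em {∃[ v ] (¬ P v × Adj G z v)} | em {∃[ u ] (P u × Adj G z u)}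
  ... | yes _  | yes z≡x | _     | _      = root z≡x
  ... | yes Pz | no z≢x  | yes b | _      = nearB Pz z≢x b
  ... | yes Pz | no z≢x  | no ¬b | _      = nearI Pz z≢x ¬b
  ... | no ¬Pz | _       | _     | yes b  = farB ¬Pz b
  ... | no ¬Pz | _       | _     | no ¬b  = farI ¬Pz ¬b

  -- A weight on the classes.
  Class : Set
  Class = ∀ {z} → View z → ℤ

  -- Indicators of the classes.
  root? nearB? nearI? near? farB? farI? far? : Class
  root?  (root _)      = 1ℤ
  root?  _             = 0ℤ
  nearB? (nearB _ _ _) = 1ℤ
  nearB? _             = 0ℤ
  nearI? (nearI _ _ _) = 1ℤ
  nearI? _             = 0ℤ
  farB?  (farB _ _)    = 1ℤ
  farB?  _             = 0ℤ
  farI?  (farI _ _)    = 1ℤ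
  farI?  _             = 0ℤ
  far?   w             = farB? w + farI? w
  near?  w             = root? w + nearB? w + nearI? w

  -- The number of neighbours of y in a class (weighted by p).
  ♯ : Class → V G → ℤ
  ♯ p y = Σ (N y) (λ z → p (view z))

  -- The number a of cut edges at x; the numbers g and h of near neighbours of x on
  -- the boundary and in the interior; the numbers A and σ of cut edges at the near
  -- neighbours and at the far neighbours of x.  The a cut edges at x count in σ.
  a g h A σ : ℤ
  a = ♯ far? x
  g = ♯ nearB? x
  h = ♯ nearI? x
  A = Σ (N x) (λ y → nearB? (view y) * ♯ far? y)
  σ = Σ (N x) (λ w → far? (view w) * ♯ near? w)

  nearB?≥0 : ∀ {z} (u : View z) → 0ℤ ≤ nearB? u
  nearB?≥0 (root _)      = ≤-refl
  nearB?≥0 (nearB _ _ _) = +≤+ ℕ.z≤n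
  nearB?≥0 (nearI _ _ _) = ≤-refl
  nearB?≥0 (farB _ _)    = ≤-refl
  nearB?≥0 (farI _ _)    = ≤-refl

  near?≥0 : ∀ {z} (u : View z) → 0ℤ ≤ near? u
  near?≥0 (root _)      = +≤+ ℕ.z≤n
  near?≥0 (nearB _ _ _) = +≤+ ℕ.z≤n
  near?≥0 (nearI _ _ _) = +≤+ ℕ.z≤n
  near?≥0 (farB _ _)    = ≤-refl
  near?≥0 (farI _ _)    = ≤-refl

  farI?≥0 : ∀ {z} (u : View z) → 0ℤ ≤ farI? u
  farI?≥0 (root _)      = ≤-refl
  farI?≥0 (nearB _ _ _) = ≤-refl
  farI?≥0 (nearI _ _ _) = ≤-refl
  farI?≥0 (farB _ _)    = ≤-refl
  farI?≥0 (farI _ _)    = +≤+ ℕ.z≤n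

  far?≥0 : ∀ {z} (u : View z) → 0ℤ ≤ far? u
  far?≥0 (root _)      = ≤-refl
  far?≥0 (nearB _ _ _) = ≤-refl
  far?≥0 (nearI _ _ _) = ≤-refl
  far?≥0 (farB _ _)    = +≤+ ℕ.z≤n
  far?≥0 (farI _ _)    = +≤+ ℕ.z≤n

  near?≡1 : ∀ {z} (u : View z) → P z → near? u ≡ 1ℤ
  near?≡1 (root _)      _  = refl
  near?≡1 (nearB _ _ _) _  = refl
  near?≡1 (nearI _ _ _) _  = refl
  near?≡1 (farB ¬Pz _)  Pz = contradiction Pz ¬Pz
  near?≡1 (farI ¬Pz _)  Pz = contradiction Pz ¬Pz

  far?≡1 : ∀ {z} (u : View z) → ¬ P z → far? u ≡ 1ℤ
  far?≡1 (root refl)    ¬Pz = contradiction Px ¬Pz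
  far?≡1 (nearB Pz _ _) ¬Pz = contradiction Pz ¬Pz
  far?≡1 (nearI Pz _ _) ¬Pz = contradiction Pz ¬Pz
  far?≡1 (farB _ _)     _   = refl
  far?≡1 (farI _ _)     _   = refl

  1≤♯near : ∀ {y z} → Adj G y z → P z → 1ℤ ≤ ♯ near? y
  1≤♯near {y} {z} yz Pz = subst (_≤ ♯ near? y) (near?≡1 (view z) Pz)
    (Σ-∈ {f = λ u → near? (view u)} (λ {u} _ → near?≥0 (view u)) (neighbour yz))

  1≤♯far : ∀ {y z} → Adj G y z → ¬ P z → 1ℤ ≤ ♯ far? y
  1≤♯far {y} {z} yz ¬Pz = subst (_≤ ♯ far? y) (far?≡1 (view z) ¬Pz)
    (Σ-∈ {f = λ u → far? (view u)} (λ {u} _ → far?≥0 (view u)) (neighbour yz))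

  ∷-unique : ∀ y → Unique (y ∷ N y)
  ∷-unique y = All.tabulate (λ z∈ y≡z → irrefl G (subst (λ t → Adj G t _) y≡z (adjacent z∈)))
    ∷ nbrs-unique {G} lf y

  far≤ : ∀ {y} → P y → ♯ far? y ≤ fibre C proj₁ y
  far≤ {y} Py = Σ≤fibre C proj₁ proj₂ y (nbrs-unique {G} lf y) (λ z → far? (view z))
    (λ {z} z∈ → pointwise (view z) (adjacent z∈))
    where
    pointwise : ∀ {z} (u : View z) → Adj G y z → far? u ≤ Σ C (λ e → ⟦ proj₁ e ≡ y ⟧ * ⟦ proj₂ e ≡ z ⟧)
    pointwise (root _)      _  = pairs≥0 C proj₁ proj₂ y _
    pointwise (nearB _ _ _) _  = pairs≥0 C proj₁ proj₂ y _
    pointwise (nearI _ _ _) _  = pairs≥0 C proj₁ proj₂ y _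
    pointwise (farB ¬Pz _)  yz = ∈⇒1≤ C proj₁ proj₂ (cut Py ¬Pz yz)
    pointwise (farI ¬Pz _)  yz = ∈⇒1≤ C proj₁ proj₂ (cut Py ¬Pz yz)

  near≤ : ∀ {w} → ¬ P w → ♯ near? w ≤ fibre C proj₂ w
  near≤ {w} ¬Pw = Σ≤fibre C proj₂ proj₁ w (nbrs-unique {G} lf w) (λ z → near? (view z))
    (λ {z} z∈ → pointwise (view z) (symm G (adjacent z∈)))
    where
    pointwise : ∀ {z} (u : View z) → Adj G z w → near? u ≤ Σ C (λ e → ⟦ proj₂ e ≡ w ⟧ * ⟦ proj₁ e ≡ z ⟧)
    pointwise (root refl)    zw = ∈⇒1≤ C proj₂ proj₁ (cut Px ¬Pw zw)
    pointwise (nearB Pz _ _) zw = ∈⇒1≤ C proj₂ proj₁ (cut Pz ¬Pw zw)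
    pointwise (nearI Pz _ _) zw = ∈⇒1≤ C proj₂ proj₁ (cut Pz ¬Pw zw)
    pointwise (farB _ _)     _  = pairs≥0 C proj₂ proj₁ w _
    pointwise (farI _ _)     _  = pairs≥0 C proj₂ proj₁ w _

  nearB*far≤ : ∀ y → nearB? (view y) * ♯ far? y ≤ fibre C proj₁ y
  nearB*far≤ y with view y
  ... | root _      = fibre≥0 C proj₁ y
  ... | nearB Py _ _ = subst (_≤ fibre C proj₁ y) (sym (*-identityˡ _)) (far≤ Py)
  ... | nearI _ _ _ = fibre≥0 C proj₁ y
  ... | farB _ _    = fibre≥0 C proj₁ y
  ... | farI _ _    = fibre≥0 C proj₁ y

  far*near≤ : ∀ w → far? (view w) * ♯ near? w ≤ fibre C proj₂ w
  far*near≤ w with view w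
  ... | root _      = fibre≥0 C proj₂ w
  ... | nearB _ _ _ = fibre≥0 C proj₂ w
  ... | nearI _ _ _ = fibre≥0 C proj₂ w
  ... | farB ¬Pw _  = subst (_≤ fibre C proj₂ w) (sym (*-identityˡ _)) (near≤ ¬Pw)
  ... | farI ¬Pw _  = subst (_≤ fibre C proj₂ w) (sym (*-identityˡ _)) (near≤ ¬Pw)

  -- The near neighbours of x and x itself are distinct near ends of cut edges.
  a+A≤k : a + A ≤ k
  a+A≤k = ≤-trans (+-mono-≤ (far≤ Px) (Σ-mono (N x) (λ {y} _ → nearB*far≤ y)))
                  (Σ-fibre C proj₁ (∷-unique x))

  σ≤k : σ ≤ k
  σ≤k = ≤-trans (Σ-mono (N x) (λ {w} _ → far*near≤ w)) (Σ-fibre C proj₂ (nbrs-unique {G} lf x))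

  -- A far boundary neighbour z of w is one of the a far neighbours of x, hence one
  -- of the a - 1 distinct from w, or z has a cut edge that is not counted in σ.
  farB-count : ∀ {w} → ¬ P w → w ∈ N x → ♯ farB? w + 1ℤ + σ ≤ k + a
  farB-count {w} ¬Pw w∈Nx = ≤-by
    ((k - (outside + σ′)) + (a - (1ℤ + inside)) + (inside + outside - ♯ farB? w) + (σ′ - σ))
    (+-nonneg (+-nonneg (+-nonneg (gap (Σ-fibre₂ C proj₂ (nbrs-unique {G} lf w) (nbrs-unique {G} lf x)))
      (gap inside≤)) (gap split)) (gap (Σ-mono (N x) (λ {w} _ → far*near≤ w))))
    (ring k outside σ′ a inside (♯ farB? w) σ)
    where
    inside outside σ′ : ℤ
    inside  = Σ (N w) (λ z → far? (view z) * ⟦ z ∈ N x ⟧)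
    outside = Σ (N w) (λ z → fibre C proj₂ z * ⟦ z ∉ N x ⟧)
    σ′      = Σ (N x) (fibre C proj₂)
    ring : ∀ k o s a i f t → k + a ≡ f + 1ℤ + t + ((k - (o + s)) + (a - (1ℤ + i)) + (i + o - f) + (s - t))
    ring = solve-∀
    inside≤ : 1ℤ + inside ≤ a
    inside≤ = subst (λ t → t + inside ≤ a) (cong₂ _*_ (far?≡1 (view w) ¬Pw) (⟦⟧-yes w∈Nx))
      (Σ-⊆ (∷-unique w) (λ z → far? (view z)) (λ z → far?≥0 (view z)))
    pointwise : ∀ {z} (u : View z) → Adj G z w → farB? u ≤ far? u * ⟦ z ∈ N x ⟧ + fibre C proj₂ z * ⟦ z ∉ N x ⟧
    pointwise {z} u zw with em {z ∈ N x} | em {z ∉ N x}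
    ... | yes z∈ | yes z∉ = contradiction z∈ z∉
    ... | no z∉  | no ¬z∉ = contradiction z∉ ¬z∉
    ... | yes _  | no _   = ≤-by (farI? u) (farI?≥0 u) (ring₁ (farB? u) (farI? u) (fibre C proj₂ z))
      where
      ring₁ : ∀ b i f → (b + i) * 1ℤ + f * 0ℤ ≡ b + i
      ring₁ = solve-∀
    ... | no _   | yes _  = subst (farB? u ≤_) (ring₂ (far? u) (fibre C proj₂ z)) (farB≤ u)
      where
      ring₂ : ∀ b f → f ≡ b * 0ℤ + f * 1ℤ
      ring₂ = solve-∀
      farB≤ : (u : View z) → farB? u ≤ fibre C proj₂ z
      farB≤ (root _)      = fibre≥0 C proj₂ z
      farB≤ (nearB _ _ _) = fibre≥0 C proj₂ z
      farB≤ (nearI _ _ _) = fibre≥0 C proj₂ z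
      farB≤ (farI _ _)    = fibre≥0 C proj₂ z
      farB≤ (farB ¬Pz (u , Pu , zu)) = ≤-trans (1≤♯near zu Pu) (near≤ ¬Pz)
    split : ♯ farB? w ≤ inside + outside
    split = subst (♯ farB? w ≤_) (Σ-+ (N w) _ _)
      (Σ-mono (N w) (λ {z} z∈ → pointwise (view z) (symm G (adjacent z∈))))

  -- If x and its near neighbours already account for all k cut edges, then every
  -- other near boundary vertex is a neighbour of x.
  nearB-count : a + A ≡ k → ∀ y → ♯ nearB? y ≤ g
  nearB-count a+A≡k y = ≤-trans (Σ-mono (N y) (λ {z} _ → pointwise (view z)))
    (Σ-⊆ (nbrs-unique {G} lf y) (λ z → nearB? (view z)) (λ z → nearB?≥0 (view z)))
    where
    outside-crowds : ∀ {z} → P z → z ≢ x → ∃[ v ] (¬ P v × Adj G z v) → z ∈ N x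
    outside-crowds {z} Pz z≢x (v , ¬Pv , zv) with em {z ∈ N x}
    ... | yes z∈ = z∈
    ... | no z∉  = contradiction (<-≤-trans k<1+a+A 1+a+A≤k) (<-irrefl refl)
      where
      k<1+a+A : k < 1ℤ + (a + A)
      k<1+a+A = subst (λ t → k < 1ℤ + t) (sym a+A≡k) (subst (_< 1ℤ + k) (+-identityˡ k) (+-monoˡ-< k (+<+ (ℕ.s≤s ℕ.z≤n))))
      unique : Unique (z ∷ x ∷ N x)
      unique = (z≢x All.∷ All.tabulate (λ u∈ z≡u → z∉ (subst (_∈ N x) (sym z≡u) u∈))) ∷ ∷-unique x
      1+a+A≤k : 1ℤ + (a + A) ≤ k
      1+a+A≤k = ≤-trans (+-mono-≤ (≤-trans (1≤♯far zv ¬Pv) (far≤ Pz))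
                  (+-mono-≤ (far≤ Px) (Σ-mono (N x) (λ {y} _ → nearB*far≤ y))))
                (Σ-fibre C proj₁ unique)
    pointwise : ∀ {z} (u : View z) → nearB? u ≤ nearB? u * ⟦ z ∈ N x ⟧
    pointwise (root _)      = ≤-refl
    pointwise (nearI _ _ _) = ≤-refl
    pointwise (farB _ _)    = ≤-refl
    pointwise (farI _ _)    = ≤-refl
    pointwise (nearB Pz z≢x b) = ≤-reflexive (sym (trans (*-identityˡ _) (⟦⟧-yes (outside-crowds Pz z≢x b))))

  ♯root≡1 : ∀ {y} → y ∈ N x → ♯ root? y ≡ 1ℤ
  ♯root≡1 {y} y∈ = trans (Σ-cong (N y) (λ {z} _ → pointwise (view z)))
    (≤-antisym (Σ-≡-unique (nbrs-unique {G} lf y)) (Σ-≡-∈ (neighbour (symm G (adjacent y∈)))))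
    where
    pointwise : ∀ {z} (u : View z) → root? u ≡ ⟦ x ≡ z ⟧
    pointwise (root z≡x)      = sym (⟦⟧-yes (sym z≡x))
    pointwise (nearB _ z≢x _) = sym (⟦⟧-no (z≢x ∘ sym))
    pointwise (nearI _ z≢x _) = sym (⟦⟧-no (z≢x ∘ sym))
    pointwise (farB ¬Pz _)    = sym (⟦⟧-no λ { refl → ¬Pz Px })
    pointwise (farI ¬Pz _)    = sym (⟦⟧-no λ { refl → ¬Pz Px })

  -- The test function and the resulting upper bound for 4Γ₂

  -- The number E bounds the contribution of the boundary vertices adjacent to an
  -- interior neighbour y of x.  The hypothesis 0≤gap says v ≤ s ≤ 3v (or the
  -- reverse); it makes the contribution of an interior vertex adjacent to a near
  -- boundary neighbour of x nonpositive, so that their number does not matter.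
  module Test (n v s E : ℤ) (0≤n : 0ℤ ≤ n) (0≤gap : 0ℤ ≤ (s - v) * (+ 3 * v - s))
    (deg≥ : ∀ y → k + + 2 ≤ Σ (N y) (λ _ → 1ℤ))
    (E≥ : ∀ {y} → y ∈ N x → (s - v) * (+ 3 * s - v) * ♯ nearB? y ≤ E) where

    val : ∀ {z} → View z → ℤ
    val (root _)      = 0ℤ
    val (nearB _ _ _) = - v
    val (nearI _ _ _) = - s
    val (farB _ _)    = n
    val (farI _ _)    = + 2 * n

    f : V G → ℤ
    f z = val (view z)

    -- α = φ n (- v) and β = φ (- v) n belong to the steps from a near boundary vertex
    -- to a far one and back; c₀ is the part of the bound for a far neighbour of x that
    -- does not depend on its number of cut edges.
    α β c₀ : ℤ
    α  = n * n + + 4 * n * v + + 3 * v * v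
    β  = + 3 * n * n + + 4 * n * v + v * v
    c₀ = + 3 * n * n - β - n * n * (+ 3 - a + σ)

    -- Upper bounds for the inner sum over the neighbours of y, where y is a neighbour
    -- of x: here a near boundary vertex, next a near interior vertex, then a far one.
    near-bound : ∀ {y} → y ∈ N x → P y → y ≢ x →
      Σ (N y) (λ z → φ (f z) (- v)) ≤ + 3 * v * v + α * ♯ far? y
    near-bound {y} y∈ Py y≢x = ≤-trans (Σ-mono (N y) (λ {z} z∈ → pointwise (view z) (adjacent z∈)))
      (≤-reflexive (trans (Σ-linear₂ (N y) (+ 3 * v * v) α (λ z → root? (view z)) (λ z → far? (view z)))
        (cong (λ t → t + α * ♯ far? y) (trans (cong (λ t → + 3 * v * v * t) (♯root≡1 y∈)) (*-identityʳ (+ 3 * v * v))))))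
      where
      pointwise : ∀ {z} (u : View z) → Adj G y z → φ (val u) (- v) ≤ + 3 * v * v * root? u + α * far? u
      pointwise (root _) _      = ≤-reflexive (ring n v)
        where
        ring : ∀ n v → (0ℤ - + 2 * - v) * (0ℤ - + 2 * - v) - - v * - v
          ≡ + 3 * v * v * 1ℤ + (n * n + + 4 * n * v + + 3 * v * v) * 0ℤ
        ring = solve-∀
      pointwise (nearB _ _ _) _ = ≤-reflexive (ring n v)
        where
        ring : ∀ n v → (- v - + 2 * - v) * (- v - + 2 * - v) - - v * - v
          ≡ + 3 * v * v * 0ℤ + (n * n + + 4 * n * v + + 3 * v * v) * 0ℤ
        ring = solve-∀
      pointwise (nearI _ _ _) _ = ≤-by _ 0≤gap (ring n v s)
        where
        ring : ∀ n v s → + 3 * v * v * 0ℤ + (n * n + + 4 * n * v + + 3 * v * v) * 0ℤ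
          ≡ (- s - + 2 * - v) * (- s - + 2 * - v) - - v * - v + (s - v) * (+ 3 * v - s)
        ring = solve-∀
      pointwise (farB _ _) _    = ≤-reflexive (ring n v)
        where
        ring : ∀ n v → (n - + 2 * - v) * (n - + 2 * - v) - - v * - v
          ≡ + 3 * v * v * 0ℤ + (n * n + + 4 * n * v + + 3 * v * v) * 1ℤ
        ring = solve-∀
      pointwise (farI _ ¬b) yz  = contradiction (y , Py , symm G yz) ¬b

    inner-bound : ∀ {y} → y ∈ N x → P y → ¬ (∃[ v ] (¬ P v × Adj G y v)) →
      Σ (N y) (λ z → φ (f z) (- s)) ≤ + 3 * s * s + (s - v) * (+ 3 * s - v) * ♯ nearB? y
    inner-bound {y} y∈ Py ¬b = ≤-trans (Σ-mono (N y) (λ {z} z∈ → pointwise (view z) (adjacent z∈)))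
      (≤-reflexive (trans (Σ-linear₂ (N y) (+ 3 * s * s) ((s - v) * (+ 3 * s - v)) (λ z → root? (view z)) (λ z → nearB? (view z)))
        (cong (λ t → t + (s - v) * (+ 3 * s - v) * ♯ nearB? y)
          (trans (cong (λ t → + 3 * s * s * t) (♯root≡1 y∈)) (*-identityʳ (+ 3 * s * s))))))
      where
      pointwise : ∀ {z} (u : View z) → Adj G y z →
        φ (val u) (- s) ≤ + 3 * s * s * root? u + (s - v) * (+ 3 * s - v) * nearB? u
      pointwise (root _) _      = ≤-reflexive (ring v s)
        where
        ring : ∀ v s → (0ℤ - + 2 * - s) * (0ℤ - + 2 * - s) - - s * - s
          ≡ + 3 * s * s * 1ℤ + (s - v) * (+ 3 * s - v) * 0ℤ
        ring = solve-∀
      pointwise (nearB _ _ _) _ = ≤-reflexive (ring v s)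
        where
        ring : ∀ v s → (- v - + 2 * - s) * (- v - + 2 * - s) - - s * - s
          ≡ + 3 * s * s * 0ℤ + (s - v) * (+ 3 * s - v) * 1ℤ
        ring = solve-∀
      pointwise (nearI _ _ _) _ = ≤-reflexive (ring v s)
        where
        ring : ∀ v s → (- s - + 2 * - s) * (- s - + 2 * - s) - - s * - s
          ≡ + 3 * s * s * 0ℤ + (s - v) * (+ 3 * s - v) * 0ℤ
        ring = solve-∀
      pointwise (farB ¬Pz _) yz = contradiction (_ , ¬Pz , yz) ¬b
      pointwise (farI ¬Pz _) yz = contradiction (_ , ¬Pz , yz) ¬b

    -- The degree of w enters here: by deg≥ and farB-count, w has at least
    -- 3 - a + σ - ♯ near? w far interior neighbours, each contributing -n².
    far-bound : ∀ {w} → w ∈ N x → ¬ P w →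
      Σ (N w) (λ z → φ (f z) n) ≤ c₀ + (β + n * n) * ♯ near? w
    far-bound {w} w∈ ¬Pw = ≤-trans (Σ-mono (N w) (λ {z} z∈ → pointwise (view z) (adjacent z∈)))
      (≤-trans (≤-reflexive (trans
          (Σ-linear₃ (N w) (+ 3 * n * n - β) β (- (n * n))
            (λ z → root? (view z)) (λ z → near? (view z)) (λ z → farI? (view z)))
          (cong (λ t → (+ 3 * n * n - β) * t + β * ♯ near? w + - (n * n) * ♯ farI? w) (♯root≡1 w∈))))
        (≤-by (n * n * ((deg - (k + + 2)) + ((k + a) - (♯ farB? w + 1ℤ + σ))))
          (*-nonneg (*-nonneg 0≤n 0≤n) (+-nonneg (gap (deg≥ w)) (gap (farB-count ¬Pw w∈))))
          (trans (ring n β (♯ near? w) (♯ farB? w) (♯ farI? w) k a σ)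
            (cong (λ t → (+ 3 * n * n - β) * 1ℤ + β * ♯ near? w + - (n * n) * ♯ farI? w
                + n * n * ((t - (k + + 2)) + ((k + a) - (♯ farB? w + 1ℤ + σ)))) (sym deg-split)))))
      where
      deg : ℤ
      deg = Σ (N w) (λ _ → 1ℤ)
      deg-split : deg ≡ ♯ near? w + ♯ farB? w + ♯ farI? w
      deg-split = trans (Σ-cong (N w) (λ {z} _ → total (view z)))
        (trans (Σ-+ (N w) _ _) (cong (λ t → t + ♯ farI? w) (Σ-+ (N w) _ _)))
        where
        total : ∀ {z} (u : View z) → 1ℤ ≡ near? u + farB? u + farI? u
        total (root _)      = refl
        total (nearB _ _ _) = refl
        total (nearI _ _ _) = refl
        total (farB _ _)    = refl
        total (farI _ _)    = refl
      ring : ∀ n β b fb fi k a σ → (+ 3 * n * n - β - n * n * (+ 3 - a + σ)) + (β + n * n) * b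
        ≡ (+ 3 * n * n - β) * 1ℤ + β * b + - (n * n) * fi
          + n * n * ((b + fb + fi - (k + + 2)) + ((k + a) - (fb + 1ℤ + σ)))
      ring = solve-∀
      pointwise : ∀ {z} (u : View z) → Adj G w z →
        φ (val u) n ≤ (+ 3 * n * n - β) * root? u + β * near? u + - (n * n) * farI? u
      pointwise (root _) _ = ≤-reflexive (ring₁ n β)
        where
        ring₁ : ∀ n β → (0ℤ - + 2 * n) * (0ℤ - + 2 * n) - n * n
          ≡ (+ 3 * n * n - β) * 1ℤ + β * 1ℤ + - (n * n) * 0ℤ
        ring₁ = solve-∀
      pointwise (nearB _ _ _) _ = ≤-reflexive (ring₁ n v)
        where
        ring₁ : ∀ n v → (- v - + 2 * n) * (- v - + 2 * n) - n * n
          ≡ (+ 3 * n * n - (+ 3 * n * n + + 4 * n * v + v * v)) * 0ℤ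
            + (+ 3 * n * n + + 4 * n * v + v * v) * 1ℤ + - (n * n) * 0ℤ
        ring₁ = solve-∀
      pointwise (nearI _ _ ¬b) wz = contradiction (w , ¬Pw , symm G wz) ¬b
      pointwise (farB _ _) _ = ≤-reflexive (ring₁ n β)
        where
        ring₁ : ∀ n β → (n - + 2 * n) * (n - + 2 * n) - n * n
          ≡ (+ 3 * n * n - β) * 0ℤ + β * 0ℤ + - (n * n) * 0ℤ
        ring₁ = solve-∀
      pointwise (farI _ _) _ = ≤-reflexive (ring₁ n β)
        where
        ring₁ : ∀ n β → (+ 2 * n - + 2 * n) * (+ 2 * n - + 2 * n) - n * n
          ≡ (+ 3 * n * n - β) * 0ℤ + β * 0ℤ + - (n * n) * 1ℤ
        ring₁ = solve-∀

    -- The three bounds combined, as a linear combination of indicators.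
    row : ∀ {y} → View y → ℤ
    row {y} u = (+ 3 * v * v * nearB? u + α * (nearB? u * ♯ far? y) + (+ 3 * s * s + E) * nearI? u)
      + (c₀ * far? u + (β + n * n) * (far? u * ♯ near? y))

    row-bound : ∀ {y} (u : View y) → y ∈ N x → Σ (N y) (λ z → φ (f z) (val u)) ≤ row u
    row-bound (root refl) y∈ = contradiction (adjacent y∈) (irrefl G)
    row-bound {y} (nearB Py y≢x _) y∈ = ≤-trans (near-bound y∈ Py y≢x)
      (≤-reflexive (ring v s α E c₀ (β + n * n) (♯ far? y) (♯ near? y)))
      where
      ring : ∀ v s α E c₀ κ p q → + 3 * v * v + α * p
        ≡ (+ 3 * v * v * 1ℤ + α * (1ℤ * p) + (+ 3 * s * s + E) * 0ℤ) + (c₀ * 0ℤ + κ * (0ℤ * q))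
      ring = solve-∀
    row-bound {y} (nearI Py _ ¬b) y∈ = ≤-trans (inner-bound y∈ Py ¬b)
      (≤-by (E - (s - v) * (+ 3 * s - v) * ♯ nearB? y) (gap (E≥ y∈))
        (ring v s α E c₀ (β + n * n) (♯ far? y) (♯ near? y) ((s - v) * (+ 3 * s - v) * ♯ nearB? y)))
      where
      ring : ∀ v s α E c₀ κ p q e →
        (+ 3 * v * v * 0ℤ + α * (0ℤ * p) + (+ 3 * s * s + E) * 1ℤ) + (c₀ * 0ℤ + κ * (0ℤ * q))
        ≡ + 3 * s * s + e + (E - e)
      ring = solve-∀
    row-bound {y} (farB ¬Py _) y∈ = ≤-trans (far-bound y∈ ¬Py)
      (≤-reflexive (ring v s α E c₀ (β + n * n) (♯ far? y) (♯ near? y)))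
      where
      ring : ∀ v s α E c₀ κ p q → c₀ + κ * q
        ≡ (+ 3 * v * v * 0ℤ + α * (0ℤ * p) + (+ 3 * s * s + E) * 0ℤ) + (c₀ * 1ℤ + κ * (1ℤ * q))
      ring = solve-∀
    row-bound (farI _ ¬b) y∈ = contradiction (x , Px , symm G (adjacent y∈)) ¬b

    Σ-row : Σ (N x) (λ y → row (view y))
      ≡ (+ 3 * v * v * g + α * A + (+ 3 * s * s + E) * h) + (c₀ * a + (β + n * n) * σ)
    Σ-row = trans (Σ-+ (N x) _ _) (cong₂ _+_
      (Σ-linear₃ (N x) (+ 3 * v * v) α (+ 3 * s * s + E)
        (λ y → nearB? (view y)) (λ y → nearB? (view y) * ♯ far? y) (λ y → nearI? (view y)))
      (Σ-linear₂ (N x) c₀ (β + n * n) (λ y → far? (view y)) (λ y → far? (view y) * ♯ near? y)))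

    Σ-by-class : ∀ (p : ℤ → ℤ) → Σ (N x) (λ y → p (f y)) ≡ p n * a + p (- v) * g + p (- s) * h
    Σ-by-class p = trans (Σ-cong (N x) (λ {y} y∈ → pointwise (view y) (adjacent y∈)))
      (Σ-linear₃ (N x) (p n) (p (- v)) (p (- s))
        (λ y → far? (view y)) (λ y → nearB? (view y)) (λ y → nearI? (view y)))
      where
      pointwise : ∀ {y} (u : View y) → Adj G x y →
        p (val u) ≡ p n * far? u + p (- v) * nearB? u + p (- s) * nearI? u
      pointwise (root refl) xx    = contradiction xx (irrefl G)
      pointwise (nearB _ _ _) _   = ring (p n) (p (- v)) (p (- s))
        where
        ring : ∀ a b c → b ≡ a * 0ℤ + b * 1ℤ + c * 0ℤ
        ring = solve-∀
      pointwise (nearI _ _ _) _   = ring (p n) (p (- v)) (p (- s))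
        where
        ring : ∀ a b c → c ≡ a * 0ℤ + b * 0ℤ + c * 1ℤ
        ring = solve-∀
      pointwise (farB _ _) _      = ring (p n) (p (- v)) (p (- s))
        where
        ring : ∀ a b c → a ≡ a * 1ℤ + b * 0ℤ + c * 0ℤ
        ring = solve-∀
      pointwise (farI _ ¬b) xy    = contradiction (x , Px , symm G xy) ¬b

    f-root : f x ≡ 0ℤ
    f-root = pointwise (view x)
      where
      pointwise : (u : View x) → val u ≡ 0ℤ
      pointwise (root _)        = refl
      pointwise (nearB _ x≢x _) = contradiction refl x≢x
      pointwise (nearI _ x≢x _) = contradiction refl x≢x
      pointwise (farB ¬Px _)    = contradiction Px ¬Px
      pointwise (farI ¬Px _)    = contradiction Px ¬Px

    -- The sum of the rows, minus deg x · Σ f², plus 2 (Σ f)².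
    U : ℤ
    U = (+ 3 * v * v * g + α * A + (+ 3 * s * s + E) * h) + (c₀ * a + (β + n * n) * σ)
      - (a + g + h) * (n * n * a + v * v * g + s * s * h)
      + + 2 * ((n * a - v * g - s * h) * (n * a - v * g - s * h))

    4Γ₂≤U : 4Γ₂ᶻ lf f x ≤ U
    4Γ₂≤U = subst (_≤ U) (sym (4Γ₂ᶻ-Σ lf f x f-root))
      (+-mono-≤
        (+-mono-≤
          (subst (Σ (N x) (λ y → Σ (N y) (λ z → φ (f z) (f y))) ≤_) Σ-row
            (Σ-mono (N x) (λ {y} y∈ → row-bound (view y) y∈)))
          (≤-reflexive (cong -_ (cong₂ _*_ Σ-1-class Σ-sq))))
        (≤-reflexive (cong (λ t → + 2 * (t * t)) Σ-f)))
      where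
      Σ-1-class : Σ (N x) (λ _ → 1ℤ) ≡ a + g + h
      Σ-1-class = trans (Σ-by-class (λ _ → 1ℤ)) (ring a g h)
        where
        ring : ∀ a g h → 1ℤ * a + 1ℤ * g + 1ℤ * h ≡ a + g + h
        ring = solve-∀
      Σ-sq : Σ (N x) (λ y → f y * f y) ≡ n * n * a + v * v * g + s * s * h
      Σ-sq = trans (Σ-by-class (λ t → t * t)) (ring n v s a g h)
        where
        ring : ∀ n v s a g h → n * n * a + - v * - v * g + - s * - s * h ≡ n * n * a + v * v * g + s * s * h
        ring = solve-∀
      Σ-f : Σ (N x) f ≡ n * a - v * g - s * h
      Σ-f = trans (Σ-by-class (λ t → t)) (ring n v s a g h)
        where
        ring : ∀ n v s a g h → n * a + - v * g + - s * h ≡ n * a - v * g - s * h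
        ring = solve-∀

  -- Comparison of U with 0

  degree-split : Σ (N x) (λ _ → 1ℤ) ≡ a + g + h
  degree-split = trans (Σ-cong (N x) (λ {y} y∈ → pointwise (view y) (adjacent y∈)))
    (trans (Σ-+ (N x) _ _) (cong (λ t → t + h) (Σ-+ (N x) _ _)))
    where
    pointwise : ∀ {y} (u : View y) → Adj G x y → 1ℤ ≡ far? u + nearB? u + nearI? u
    pointwise (root refl) xx  = contradiction xx (irrefl G)
    pointwise (nearB _ _ _) _ = refl
    pointwise (nearI _ _ _) _ = refl
    pointwise (farB _ _) _    = refl
    pointwise (farI _ _) _    = refl

  -- Each near boundary vertex has a cut edge.
  g≤A : g ≤ A
  g≤A = Σ-mono (N x) (λ {y} _ → pointwise (view y))
    where
    pointwise : ∀ {y} (u : View y) → nearB? u ≤ nearB? u * ♯ far? y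
    pointwise (root _)      = ≤-refl
    pointwise (nearI _ _ _) = ≤-refl
    pointwise (farB _ _)    = ≤-refl
    pointwise (farI _ _)    = ≤-refl
    pointwise (nearB _ _ (v , ¬Pv , yv)) = ≤-trans (1≤♯far yv ¬Pv) (≤-reflexive (sym (*-identityˡ _)))

  -- Each far neighbour of x has the cut edge to x.
  a≤σ : a ≤ σ
  a≤σ = Σ-mono (N x) (λ {w} w∈ → pointwise (view w) (adjacent w∈))
    where
    pointwise : ∀ {w} (u : View w) → Adj G x w → far? u ≤ far? u * ♯ near? w
    pointwise (root _)      _  = ≤-refl
    pointwise (nearB _ _ _) _  = ≤-refl
    pointwise (nearI _ _ _) _  = ≤-refl
    pointwise (farB _ _)    xw = ≤-trans (1≤♯near (symm G xw) Px) (≤-reflexive (sym (*-identityˡ _)))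
    pointwise (farI _ _)    xw = ≤-trans (1≤♯near (symm G xw) Px) (≤-reflexive (sym (*-identityˡ _)))

  σ≤ : ∀ m → (∀ {w} → ¬ P w → ♯ near? w ≤ m) → σ ≤ m * a
  σ≤ m ≤m = ≤-trans (Σ-mono (N x) (λ {w} _ → pointwise (view w)))
    (≤-reflexive (Σ-* (N x) m (λ w → far? (view w))))
    where
    pointwise : ∀ {w} (u : View w) → far? u * ♯ near? w ≤ m * far? u
    pointwise (root _)      = ≤-reflexive (sym (*-zeroʳ m))
    pointwise (nearB _ _ _) = ≤-reflexive (sym (*-zeroʳ m))
    pointwise (nearI _ _ _) = ≤-reflexive (sym (*-zeroʳ m))
    pointwise (farB ¬Pw _)  = ≤-trans (≤-reflexive (*-identityˡ _)) (≤-trans (≤m ¬Pw) (≤-reflexive (sym (*-identityʳ m))))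
    pointwise (farI ¬Pw _)  = ≤-trans (≤-reflexive (*-identityˡ _)) (≤-trans (≤m ¬Pw) (≤-reflexive (sym (*-identityʳ m))))

  0≤g : 0ℤ ≤ g
  0≤g = Σ-nonneg (N x) (λ {y} _ → nearB?≥0 (view y))

  module _ (curved : ∀ f → 0ℤ ≤ 4Γ₂ᶻ lf f x) (deg≥ : ∀ y → k + + 2 ≤ Σ (N y) (λ _ → 1ℤ)) where

    i : ℤ
    i = g + h

    k+2≤a+i : k + + 2 ≤ a + i
    k+2≤a+i = subst (k + + 2 ≤_) (trans degree-split (+-assoc a g h)) (deg≥ x)

    0≤i-2-A : 0ℤ ≤ i - + 2 - A
    0≤i-2-A = subst (0ℤ ≤_) (ring k a i A) (+-nonneg (gap k+2≤a+i) (gap a+A≤k))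
      where
      ring : ∀ k a i A → (a + i - (k + + 2)) + (k - (a + A)) ≡ i - + 2 - A
      ring = solve-∀

    0≤i-2-B : 0ℤ ≤ i - + 2 - (σ - a)
    0≤i-2-B = subst (0ℤ ≤_) (ring k a i σ) (+-nonneg (gap k+2≤a+i) (gap σ≤k))
      where
      ring : ∀ k a i σ → (a + i - (k + + 2)) + (k - σ) ≡ i - + 2 - (σ - a)
      ring = solve-∀

    0≤A : 0ℤ ≤ A
    0≤A = ≤-trans 0≤g g≤A

    0≤B : 0ℤ ≤ σ - a
    0≤B = gap a≤σ

    0≤i-2 : 0ℤ ≤ i - + 2
    0≤i-2 = subst (0ℤ ≤_) (ring i A) (+-nonneg 0≤i-2-A 0≤A)
      where
      ring : ∀ i A → i - + 2 - A + A ≡ i - + 2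
      ring = solve-∀

    0≤i : 0ℤ ≤ i
    0≤i = subst (0ℤ ≤_) (ring i) (+-nonneg 0≤i-2 (+≤+ {n = 2} ℕ.z≤n))
      where
      ring : ∀ i → i - + 2 + + 2 ≡ i
      ring = solve-∀

    -- The bound U for v = s = 1, in terms of B = σ - a, the number of cut edges at
    -- the far neighbours of x that do not end in x.
    U₁ : ℤ → ℤ → ℤ → ℤ → ℤ → ℤ
    U₁ n i a A B = + 3 * i + (n * n + + 4 * n + + 3) * A + a * (n * n)
      + B * (+ 4 * (n * n) + + 4 * n + 1ℤ - a * (n * n))
      - (a + i) * (n * n * a + i) + + 2 * ((n * a - i) * (n * a - i))

    0≤U₁ : ∀ n → 0ℤ ≤ n → 0ℤ ≤ U₁ n i a A (σ - a)
    0≤U₁ n 0≤n = subst (0ℤ ≤_) (ring n a g h A σ) (≤-trans (curved T.f) T.4Γ₂≤U)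
      where
      module T = Test n 1ℤ 1ℤ 0ℤ 0≤n ≤-refl deg≥ (λ _ → ≤-refl)
      ring : ∀ n a g h A σ →
        let α = n * n + + 4 * n * 1ℤ + + 3 * 1ℤ * 1ℤ
            β = + 3 * n * n + + 4 * n * 1ℤ + 1ℤ * 1ℤ
            c₀ = + 3 * n * n - β - n * n * (+ 3 - a + σ)
            i = g + h
            B = σ - a
        in
        (+ 3 * 1ℤ * 1ℤ * g + α * A + (+ 3 * 1ℤ * 1ℤ + 0ℤ) * h) + (c₀ * a + (β + n * n) * σ)
          - (a + g + h) * (n * n * a + 1ℤ * 1ℤ * g + 1ℤ * 1ℤ * h)
          + + 2 * ((n * a - 1ℤ * g - 1ℤ * h) * (n * a - 1ℤ * g - 1ℤ * h))
        ≡ + 3 * i + (n * n + + 4 * n + + 3) * A + a * (n * n)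
          + B * (+ 4 * (n * n) + + 4 * n + 1ℤ - a * (n * n))
          - (a + i) * (n * n * a + i) + + 2 * ((n * a - i) * (n * a - i))
      ring = solve-∀

    U₁-absurd : ∀ n r → 0ℤ ≤ n → 0ℤ ≤ r → ¬ (U₁ n i a A (σ - a) ≡ - (1ℤ + r))
    U₁-absurd n r 0≤n 0≤r U≡ = negative-absurd r 0≤r U≡ (0≤U₁ n 0≤n)

    α≥0 : ∀ {n} → 0ℤ ≤ n → 0ℤ ≤ n * n + + 4 * n + + 3
    α≥0 0≤n = +-nonneg (+-nonneg (*-nonneg 0≤n 0≤n) (*-nonneg {+ 4} (+≤+ ℕ.z≤n) 0≤n)) (+≤+ ℕ.z≤n)

    -- The coefficient of B in U₁ at n = i is 4i + 1 - (a - 4) i²: the first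
    -- part is estimated by B ≤ i - 2, and the second is nonpositive.
    a≥4-absurd : + 4 ≤ a → a ≤ i → ⊥
    a≥4-absurd 4≤a a≤i = U₁-absurd i r 0≤i r≥0 (ring i a A (σ - a))
      where
      B q p : ℤ
      B = σ - a
      q = a - + 4
      p = i - a
      r : ℤ
      r = i * i * ((+ 3 + q) * p + + 2 * q + 1ℤ) + (+ 13 + q) * i + + 7
        + (i * i + + 4 * i + + 3) * (i - + 2 - A) + (+ 4 * i + 1ℤ) * (i - + 2 - B) + q * (i * i) * B
      0≤q : 0ℤ ≤ q
      0≤q = gap 4≤a
      r≥0 : 0ℤ ≤ r
      r≥0 = +-nonneg (+-nonneg (+-nonneg (+-nonneg (+-nonneg
        (*-nonneg (sq-nonneg i) (+-nonneg (+-nonneg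
          (*-nonneg (+-nonneg {+ 3} (+≤+ ℕ.z≤n) 0≤q) (gap a≤i)) (*-nonneg {+ 2} (+≤+ ℕ.z≤n) 0≤q)) (+≤+ ℕ.z≤n)))
        (*-nonneg (+-nonneg {+ 13} (+≤+ ℕ.z≤n) 0≤q) 0≤i)) (+≤+ ℕ.z≤n))
        (*-nonneg (α≥0 0≤i) 0≤i-2-A))
        (*-nonneg (+-nonneg (*-nonneg {+ 4} (+≤+ ℕ.z≤n) 0≤i) (+≤+ ℕ.z≤n)) 0≤i-2-B))
        (*-nonneg (*-nonneg 0≤q (sq-nonneg i)) 0≤B)
      ring : ∀ i a A B →
        + 3 * i + (i * i + + 4 * i + + 3) * A + a * (i * i)
          + B * (+ 4 * (i * i) + + 4 * i + 1ℤ - a * (i * i))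
          - (a + i) * (i * i * a + i) + + 2 * ((i * a - i) * (i * a - i))
        ≡ - (1ℤ + (i * i * ((+ 3 + (a - + 4)) * (i - a) + + 2 * (a - + 4) + 1ℤ) + (+ 13 + (a - + 4)) * i + + 7
          + (i * i + + 4 * i + + 3) * (i - + 2 - A) + (+ 4 * i + 1ℤ) * (i - + 2 - B)
          + (a - + 4) * (i * i) * B))
      ring = solve-∀

    a≡3-absurd : a ≡ + 3 → ⊥
    a≡3-absurd a≡3 = U₁-absurd i r 0≤i r≥0 (trans (cong (λ t → U₁ i i t A (σ - a)) a≡3) (ring i A (σ - a)))
      where
      B p r : ℤ
      B = σ - a
      p = i - + 2
      r = p * p * p + p * p + + 4 * p + + 19
        + (i * i + + 4 * i + + 3) * (p - A) + (i * i + + 4 * i + 1ℤ) * (p - B)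
      r≥0 : 0ℤ ≤ r
      r≥0 = +-nonneg (+-nonneg (+-nonneg (+-nonneg (+-nonneg
        (*-nonneg (sq-nonneg p) 0≤i-2) (sq-nonneg p)) (*-nonneg {+ 4} (+≤+ ℕ.z≤n) 0≤i-2)) (+≤+ ℕ.z≤n))
        (*-nonneg (α≥0 0≤i) 0≤i-2-A))
        (*-nonneg (+-nonneg (+-nonneg (sq-nonneg i) (*-nonneg {+ 4} (+≤+ ℕ.z≤n) 0≤i)) (+≤+ ℕ.z≤n)) 0≤i-2-B)
      ring : ∀ i A B →
        + 3 * i + (i * i + + 4 * i + + 3) * A + + 3 * (i * i)
          + B * (+ 4 * (i * i) + + 4 * i + 1ℤ - + 3 * (i * i))
          - (+ 3 + i) * (i * i * + 3 + i) + + 2 * ((i * + 3 - i) * (i * + 3 - i))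
        ≡ - (1ℤ + ((i - + 2) * (i - + 2) * (i - + 2) + (i - + 2) * (i - + 2) + + 4 * (i - + 2) + + 19
          + (i * i + + 4 * i + + 3) * (i - + 2 - A) + (i * i + + 4 * i + 1ℤ) * (i - + 2 - B)))
      ring = solve-∀

    -- Here B = 0, and n must be large compared with i: for n = i and A = i - 2, the
    -- value of U₁ is i² - 3i - 6.
    a≡1-absurd : a ≡ 1ℤ → σ ≤ a → ⊥
    a≡1-absurd a≡1 σ≤a = U₁-absurd (i * i) r (sq-nonneg i) r≥0
      (trans (cong (λ t → U₁ (i * i) i t A (σ - a)) a≡1) (ring i A (σ - a)))
      where
      B p n r : ℤ
      B = σ - a
      p = i - + 2
      n = i * i
      r = + 7 * (p * p) + + 23 * p + + 23
        + (n * n + + 4 * n + + 3) * (p - A) + (+ 3 * (n * n) + + 4 * n + 1ℤ) * - B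
      0≤-B : 0ℤ ≤ - B
      0≤-B = neg-mono-≤ (i≤j⇒i-j≤0 σ≤a)
      r≥0 : 0ℤ ≤ r
      r≥0 = +-nonneg (+-nonneg (+-nonneg (+-nonneg
        (*-nonneg {+ 7} (+≤+ ℕ.z≤n) (sq-nonneg p)) (*-nonneg {+ 23} (+≤+ ℕ.z≤n) 0≤i-2)) (+≤+ ℕ.z≤n))
        (*-nonneg (α≥0 (sq-nonneg i)) 0≤i-2-A))
        (*-nonneg (+-nonneg (+-nonneg (*-nonneg {+ 3} (+≤+ ℕ.z≤n) (sq-nonneg n))
          (*-nonneg {+ 4} (+≤+ ℕ.z≤n) (sq-nonneg i))) (+≤+ ℕ.z≤n)) 0≤-B)
      ring : ∀ i A B →
        + 3 * i + (i * i * (i * i) + + 4 * (i * i) + + 3) * A + 1ℤ * (i * i * (i * i))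
          + B * (+ 4 * (i * i * (i * i)) + + 4 * (i * i) + 1ℤ - 1ℤ * (i * i * (i * i)))
          - (1ℤ + i) * (i * i * (i * i) * 1ℤ + i) + + 2 * ((i * i * 1ℤ - i) * (i * i * 1ℤ - i))
        ≡ - (1ℤ + (+ 7 * ((i - + 2) * (i - + 2)) + + 23 * (i - + 2) + + 23
          + (i * i * (i * i) + + 4 * (i * i) + + 3) * (i - + 2 - A)
          + (+ 3 * (i * i * (i * i)) + + 4 * (i * i) + 1ℤ) * - B))
      ring = solve-∀

    -- For a = 2 one has B ≤ 2 in the application.  With n = i, negativity of U₁ can
    -- fail only for B = 2, A = i - 2 and i ∈ {4, 5}.
    module _ (a≡2 : a ≡ + 2) where

      private
        B p : ℤ
        B = σ - a
        p = i - + 2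

        coef≥0 : 0ℤ ≤ + 2 * (i * i) + + 4 * i + 1ℤ
        coef≥0 = +-nonneg (+-nonneg (*-nonneg {+ 2} (+≤+ ℕ.z≤n) (sq-nonneg i)) (*-nonneg {+ 4} (+≤+ ℕ.z≤n) 0≤i)) (+≤+ ℕ.z≤n)

        σ≤4⇒B≤2 : σ ≤ + 4 → B ≤ + 2
        σ≤4⇒B≤2 σ≤4 = subst (λ t → σ - t ≤ + 2) (sym a≡2) (+-monoˡ-≤ (- + 2) σ≤4)

        absurd : ∀ r → 0ℤ ≤ r → ¬ (U₁ i i (+ 2) A B ≡ - (1ℤ + r))
        absurd r 0≤r eq = U₁-absurd i r 0≤i 0≤r (trans (cong (λ t → U₁ i i t A B) a≡2) eq)

      B≤1-absurd : B ≤ 1ℤ → ⊥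
      B≤1-absurd B≤1 = absurd _ (+-nonneg (+-nonneg
          (+-nonneg (*-nonneg (sq-nonneg p) 0≤i-2) (*-nonneg {+ 3} (+≤+ ℕ.z≤n) (sq-nonneg p)))
          (*-nonneg (α≥0 0≤i) 0≤i-2-A)) (*-nonneg coef≥0 (gap B≤1)))
        (ring i A B)
        where
        ring : ∀ i A B →
          + 3 * i + (i * i + + 4 * i + + 3) * A + + 2 * (i * i)
            + B * (+ 4 * (i * i) + + 4 * i + 1ℤ - + 2 * (i * i))
            - (+ 2 + i) * (i * i * + 2 + i) + + 2 * ((i * + 2 - i) * (i * + 2 - i))
          ≡ - (1ℤ + ((i - + 2) * (i - + 2) * (i - + 2) + + 3 * ((i - + 2) * (i - + 2))
            + (i * i + + 4 * i + + 3) * (i - + 2 - A) + (+ 2 * (i * i) + + 4 * i + 1ℤ) * (1ℤ - B)))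
        ring = solve-∀

      A≤i-3-absurd : B ≤ + 2 → + 4 ≤ i → A ≤ i - + 3 → ⊥
      A≤i-3-absurd B≤2 4≤i A≤ = absurd _ (+-nonneg (+-nonneg (+-nonneg (+-nonneg
          (+-nonneg (*-nonneg (sq-nonneg q) 0≤q) (*-nonneg {+ 8} (+≤+ ℕ.z≤n) (sq-nonneg q)))
          (*-nonneg {+ 16} (+≤+ ℕ.z≤n) 0≤q)) (+≤+ {n = 6} ℕ.z≤n))
          (*-nonneg (α≥0 0≤i) (gap A≤))) (*-nonneg coef≥0 (gap B≤2)))
        (ring i A B)
        where
        q = i - + 4
        0≤q : 0ℤ ≤ q
        0≤q = gap 4≤i
        ring : ∀ i A B →
          + 3 * i + (i * i + + 4 * i + + 3) * A + + 2 * (i * i)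
            + B * (+ 4 * (i * i) + + 4 * i + 1ℤ - + 2 * (i * i))
            - (+ 2 + i) * (i * i * + 2 + i) + + 2 * ((i * + 2 - i) * (i * + 2 - i))
          ≡ - (1ℤ + ((i - + 4) * (i - + 4) * (i - + 4) + + 8 * ((i - + 4) * (i - + 4)) + + 16 * (i - + 4) + + 6
            + (i * i + + 4 * i + + 3) * (i - + 3 - A) + (+ 2 * (i * i) + + 4 * i + 1ℤ) * (+ 2 - B)))
        ring = solve-∀

      i≥6-absurd : B ≤ + 2 → + 6 ≤ i → ⊥
      i≥6-absurd B≤2 6≤i = absurd _ (+-nonneg (+-nonneg (+-nonneg (+-nonneg
          (+-nonneg (*-nonneg (sq-nonneg q) 0≤q) (*-nonneg {+ 13} (+≤+ ℕ.z≤n) (sq-nonneg q)))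
          (*-nonneg {+ 44} (+≤+ ℕ.z≤n) 0≤q)) (+≤+ {n = 15} ℕ.z≤n))
          (*-nonneg (α≥0 0≤i) 0≤i-2-A)) (*-nonneg coef≥0 (gap B≤2)))
        (ring i A B)
        where
        q = i - + 6
        0≤q : 0ℤ ≤ q
        0≤q = gap 6≤i
        ring : ∀ i A B →
          + 3 * i + (i * i + + 4 * i + + 3) * A + + 2 * (i * i)
            + B * (+ 4 * (i * i) + + 4 * i + 1ℤ - + 2 * (i * i))
            - (+ 2 + i) * (i * i * + 2 + i) + + 2 * ((i * + 2 - i) * (i * + 2 - i))
          ≡ - (1ℤ + ((i - + 6) * (i - + 6) * (i - + 6) + + 13 * ((i - + 6) * (i - + 6)) + + 44 * (i - + 6) + + 15
            + (i * i + + 4 * i + + 3) * (i - + 2 - A) + (+ 2 * (i * i) + + 4 * i + 1ℤ) * (+ 2 - B)))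
        ring = solve-∀

      -- The bound U for a = 2, σ = 4 with n = 6, v = 1, s = 3.  The tightness of
      -- a + A ≤ k bounds by g the number of boundary neighbours of an interior
      -- neighbour of x, whence E = 16 g.
      S : ℤ → ℤ → ℤ → ℤ
      S g h A = + 3 * g + + 63 * A + (+ 27 + + 16 * g) * h + + 266
        - (+ 2 + g + h) * (+ 72 + g + + 9 * h) + + 2 * ((+ 12 - g - + 3 * h) * (+ 12 - g - + 3 * h))

      0≤S : σ ≡ + 4 → a + A ≡ k → 0ℤ ≤ S g h A
      0≤S σ≡4 a+A≡k = subst (0ℤ ≤_) U≡S (≤-trans (curved T.f) T.4Γ₂≤U)
        where
        module T = Test (+ 6) 1ℤ (+ 3) (+ 16 * g) (+≤+ ℕ.z≤n) ≤-refl deg≥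
          (λ {y} _ → *-monoˡ-≤-nonNeg (+ 16) (nearB-count a+A≡k y))
        U-at : ℤ → ℤ → ℤ → ℤ → ℤ → ℤ
        U-at a σ g h A =
          (+ 3 * g + + 63 * A + (+ 27 + + 16 * g) * h) + ((- + 25 - + 36 * (+ 3 - a + σ)) * a + + 169 * σ)
            - (a + g + h) * (+ 36 * a + 1ℤ * g + + 9 * h)
            + + 2 * ((+ 6 * a - 1ℤ * g - + 3 * h) * (+ 6 * a - 1ℤ * g - + 3 * h))
        ring : ∀ g h A →
          (+ 3 * g + + 63 * A + (+ 27 + + 16 * g) * h)
            + ((- + 25 - + 36 * (+ 3 - + 2 + + 4)) * + 2 + + 169 * + 4)
            - (+ 2 + g + h) * (+ 36 * + 2 + 1ℤ * g + + 9 * h)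
            + + 2 * ((+ 6 * + 2 - 1ℤ * g - + 3 * h) * (+ 6 * + 2 - 1ℤ * g - + 3 * h))
          ≡ + 3 * g + + 63 * A + (+ 27 + + 16 * g) * h + + 266
            - (+ 2 + g + h) * (+ 72 + g + + 9 * h) + + 2 * ((+ 12 - g - + 3 * h) * (+ 12 - g - + 3 * h))
        ring = solve-∀
        U≡S : T.U ≡ S g h A
        U≡S = trans (cong₂ (λ s t → U-at s t g h A) a≡2 σ≡4) (ring g h A)

      -- With h = m - g, the polynomial S is quadratic in g; it is negative for
      -- g ≤ A = m - 2.
      tight-absurd : ∀ m → i ≡ m → A ≡ m - + 2 → (m ≡ + 4 ⊎ m ≡ + 5) → σ ≡ + 4 → a + A ≡ k → ⊥
      tight-absurd m i≡m A≡m-2 m≡ σ≡4 a+A≡k =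
        refute m≡ (subst₂ (λ s t → 0ℤ ≤ S g s t) h≡ A≡m-2 (0≤S σ≡4 a+A≡k)) (gap (subst (g ≤_) A≡m-2 g≤A))
        where
        h≡ : h ≡ m - g
        h≡ = trans (ring g h) (cong (λ t → t - g) i≡m)
          where
          ring : ∀ g h → h ≡ g + h - g
          ring = solve-∀
        refute : ∀ {m} → m ≡ + 4 ⊎ m ≡ + 5 → 0ℤ ≤ S g (m - g) (m - + 2) → ¬ (0ℤ ≤ m - + 2 - g)
        refute (inj₁ refl) S≥0 0≤r = negative-absurd _
          (+-nonneg (+-nonneg {+ 3} (+≤+ ℕ.z≤n) (*-nonneg {+ 56} (+≤+ ℕ.z≤n) 0≤r))
            (*-nonneg {+ 8} (+≤+ ℕ.z≤n) (sq-nonneg (+ 2 - g)))) (ring g) S≥0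
          where
          ring : ∀ g → + 3 * g + + 63 * + 2 + (+ 27 + + 16 * g) * (+ 4 - g) + + 266
              - (+ 2 + g + (+ 4 - g)) * (+ 72 + g + + 9 * (+ 4 - g))
              + + 2 * ((+ 12 - g - + 3 * (+ 4 - g)) * (+ 12 - g - + 3 * (+ 4 - g)))
            ≡ - (1ℤ + (+ 3 + + 56 * (+ 2 - g) + + 8 * ((+ 2 - g) * (+ 2 - g))))
          ring = solve-∀
        refute (inj₂ refl) S≥0 0≤r = negative-absurd _
          (+-nonneg (+-nonneg {+ 18} (+≤+ ℕ.z≤n) (*-nonneg {+ 40} (+≤+ ℕ.z≤n) 0≤r))
            (*-nonneg {+ 8} (+≤+ ℕ.z≤n) (sq-nonneg (+ 3 - g)))) (ring g) S≥0
          where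
          ring : ∀ g → + 3 * g + + 63 * + 3 + (+ 27 + + 16 * g) * (+ 5 - g) + + 266
              - (+ 2 + g + (+ 5 - g)) * (+ 72 + g + + 9 * (+ 5 - g))
              + + 2 * ((+ 12 - g - + 3 * (+ 5 - g)) * (+ 12 - g - + 3 * (+ 5 - g)))
            ≡ - (1ℤ + (+ 18 + + 40 * (+ 3 - g) + + 8 * ((+ 3 - g) * (+ 3 - g))))
          ring = solve-∀

      a≡2-absurd : σ ≤ + 4 → ⊥
      a≡2-absurd σ≤4 with B ≤? 1ℤ | + 6 ≤? i | A ≤? i - + 3
      ... | yes B≤1 | _       | _      = B≤1-absurd B≤1
      ... | no _    | yes 6≤i | _      = i≥6-absurd (σ≤4⇒B≤2 σ≤4) 6≤i
      ... | no B≰1  | no 6≰i  | A≤?    = narrow A≤?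
        where
        B≤2 : B ≤ + 2
        B≤2 = σ≤4⇒B≤2 σ≤4
        σ≡4 : σ ≡ + 4
        σ≡4 = trans (ring σ a) (cong₂ _+_ (≤-antisym B≤2 (i<j⇒suc[i]≤j (≰⇒> B≰1))) a≡2)
          where
          ring : ∀ σ a → σ ≡ σ - a + a
          ring = solve-∀
        k≤i : k ≤ i
        k≤i = ≤-by (a + i - (k + + 2)) (gap k+2≤a+i)
          (trans (ring k i) (cong (λ t → k + (t + i - (k + + 2))) (sym a≡2)))
          where
          ring : ∀ k i → i ≡ k + (+ 2 + i - (k + + 2))
          ring = solve-∀
        4≤i : + 4 ≤ i
        4≤i = ≤-trans (subst (_≤ k) σ≡4 σ≤k) k≤i
        i≡4or5 : i ≡ + 4 ⊎ i ≡ + 5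
        i≡4or5 with i ≟ + 4
        ... | yes i≡4 = inj₁ i≡4
        ... | no  i≢4 = inj₂ (≤-antisym (i<j⇒i≤pred[j] (≰⇒> 6≰i)) (i<j⇒suc[i]≤j (≤∧≢⇒< 4≤i (i≢4 ∘ sym))))
        narrow : Dec (A ≤ i - + 3) → ⊥
        narrow (yes A≤) = A≤i-3-absurd B≤2 4≤i A≤
        narrow (no A≰)  = tight-absurd i refl A≡ i≡4or5 σ≡4 (≤-antisym a+A≤k k≤a+A)
          where
          A≡ : A ≡ i - + 2
          A≡ = ≤-antisym (0≤i-j⇒j≤i 0≤i-2-A) (subst (_≤ A) (ring i) (i<j⇒suc[i]≤j (≰⇒> A≰)))
            where
            ring : ∀ i → 1ℤ + (i - + 3) ≡ i - + 2
            ring = solve-∀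
          k≤a+A : k ≤ a + A
          k≤a+A = subst (k ≤_) (trans (ring i) (sym (cong₂ _+_ a≡2 A≡))) k≤i
            where
            ring : ∀ i → i ≡ + 2 + (i - + 2)
            ring = solve-∀

-- Eliminating the cut

module Global (em : ExcludedMiddle 0ℓ) {G : Graph} (lf : LocallyFinite G)
  (connected : Connected G) (curved : ∀ f x → 0ℤ ≤ 4Γ₂ᶻ lf f x) where

  open Indicator em

  N : V G → List (V G)
  N = nbrs {G} lf

  -- The number of neighbours of y that satisfy Q.  For x in P, count (∁ P) x is the
  -- number of cut edges at x.
  count : (V G → Set) → V G → ℤ
  count Q y = Σ (N y) (λ z → ⟦ Q z ⟧)

  deg : V G → ℤ
  deg y = Σ (N y) (λ _ → 1ℤ)

  ∁ : (V G → Set) → V G → Set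
  ∁ P z = ¬ P z

  -- C contains every edge from P to its complement, in this direction.
  CutSet : (V G → Set) → List (V G × V G) → Set
  CutSet P C = ∀ {u v} → P u → ¬ P v → Adj G u v → (u , v) ∈ C

  -- Every degree is at least m + 2.
  Thick : ℕ → Set
  Thick m = ∀ y → + m + + 2 ≤ deg y

  ⟦⟧-¬ : ∀ Q → 1ℤ ≡ ⟦ Q ⟧ + ⟦ ¬ Q ⟧
  ⟦⟧-¬ Q with em {Q} | em {¬ Q}
  ... | yes q | yes ¬q = contradiction q ¬q
  ... | yes _ | no _   = refl
  ... | no _  | yes _  = refl
  ... | no ¬q | no ¬¬q = contradiction ¬q ¬¬q

  ⟦⟧-¬¬ : ∀ Q → ⟦ ¬ ¬ Q ⟧ ≡ ⟦ Q ⟧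
  ⟦⟧-¬¬ Q with em {Q}
  ... | yes q = ⟦⟧-yes λ ¬q → ¬q q
  ... | no ¬q = ⟦⟧-no λ ¬¬q → ¬¬q ¬q

  deg-split : ∀ Q y → deg y ≡ count Q y + count (∁ Q) y
  deg-split Q y = trans (Σ-cong (N y) (λ {z} _ → ⟦⟧-¬ (Q z))) (Σ-+ (N y) _ _)

  count-¬¬ : ∀ Q y → count (∁ (∁ Q)) y ≡ count Q y
  count-¬¬ Q y = Σ-cong (N y) (λ {z} _ → ⟦⟧-¬¬ (Q z))

  -- The same cut seen from the other side.
  CutSet-swap : ∀ {P C} → CutSet P C → CutSet (∁ P) (List.map swap C)
  CutSet-swap {P} cut {u} {v} ¬Pu ¬¬Pv uv with em {P v}
  ... | yes Pv = ∈-map⁺ swap (cut Pv ¬Pu (symm G uv))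
  ... | no ¬Pv = contradiction ¬Pv ¬¬Pv

  module _ {P : V G → Set} {C : List (V G × V G)} (cut : CutSet P C) {x : V G} (Px : P x) where

    open Local em lf P C cut x Px hiding (N)

    far≡ : ∀ y → ♯ far? y ≡ count (∁ P) y
    far≡ y = Σ-cong (N y) (λ {z} _ → pointwise (view z))
      where
      pointwise : ∀ {z} (u : View z) → far? u ≡ ⟦ ¬ P z ⟧
      pointwise (root refl)    = sym (⟦⟧-no λ ¬Px → ¬Px Px)
      pointwise (nearB Pz _ _) = sym (⟦⟧-no λ ¬Pz → ¬Pz Pz)
      pointwise (nearI Pz _ _) = sym (⟦⟧-no λ ¬Pz → ¬Pz Pz)
      pointwise (farB ¬Pz _)   = sym (⟦⟧-yes ¬Pz)
      pointwise (farI ¬Pz _)   = sym (⟦⟧-yes ¬Pz)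

    near≡ : ∀ y → ♯ near? y ≡ count P y
    near≡ y = Σ-cong (N y) (λ {z} _ → pointwise (view z))
      where
      pointwise : ∀ {z} (u : View z) → near? u ≡ ⟦ P z ⟧
      pointwise (root refl)    = sym (⟦⟧-yes Px)
      pointwise (nearB Pz _ _) = sym (⟦⟧-yes Pz)
      pointwise (nearI Pz _ _) = sym (⟦⟧-yes Pz)
      pointwise (farB ¬Pz _)   = sym (⟦⟧-no ¬Pz)
      pointwise (farI ¬Pz _)   = sym (⟦⟧-no ¬Pz)

    count≤fibre : count (∁ P) x ≤ fibre C proj₁ x
    count≤fibre = subst (_≤ fibre C proj₁ x) (far≡ x) (far≤ Px)

    module _ (thick : Thick (length C)) where

      private
        deg≥ : ∀ y → size {V G} C + + 2 ≤ deg y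
        deg≥ y = subst (λ t → t + + 2 ≤ deg y) (sym (Σ-1 C)) (thick y)

      crossing≥3-absurd : + 3 ≤ count (∁ P) x → count (∁ P) x ≤ count P x → ⊥
      crossing≥3-absurd 3≤ bal with count (∁ P) x ≟ + 3
      ... | yes ≡3 = a≡3-absurd (λ f → curved f x) deg≥ (trans (far≡ x) ≡3)
      ... | no ≢3  = a≥4-absurd (λ f → curved f x) deg≥
        (subst (+ 4 ≤_) (sym (far≡ x)) (i<j⇒suc[i]≤j (≤∧≢⇒< 3≤ (≢3 ∘ sym))))
        (subst₂ _≤_ (sym (far≡ x)) near-split bal)
        where
        near-split : count P x ≡ g + h
        near-split = ∙-cancelʳ +-0-abelianGroup (count (∁ P) x) _ _ (trans (sym (deg-split P x))
          (trans degree-split (trans (ring (♯ far? x) (♯ nearB? x) (♯ nearI? x))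
            (cong (λ t → ♯ nearB? x + ♯ nearI? x + t) (far≡ x)))))
          where
          ring : ∀ a g h → a + g + h ≡ g + h + a
          ring = solve-∀

      crossing≡2-absurd : count (∁ P) x ≡ + 2 → (∀ w → ¬ P w → count P w ≤ + 2) → ⊥
      crossing≡2-absurd ≡2 ≤2 = a≡2-absurd (λ f → curved f x) deg≥ (trans (far≡ x) ≡2)
        (≤-trans (σ≤ (+ 2) (λ {w} ¬Pw → subst (_≤ + 2) (sym (near≡ w)) (≤2 w ¬Pw)))
          (≤-reflexive (cong (λ t → + 2 * t) (trans (far≡ x) ≡2))))

      crossing≡1-absurd : count (∁ P) x ≡ 1ℤ → (∀ w → ¬ P w → count P w ≤ 1ℤ) → ⊥
      crossing≡1-absurd ≡1 ≤1 = a≡1-absurd (λ f → curved f x) deg≥ (trans (far≡ x) ≡1)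
        (≤-trans (σ≤ 1ℤ (λ {w} ¬Pw → subst (_≤ 1ℤ) (sym (near≡ w)) (≤1 w ¬Pw)))
          (≤-reflexive (*-identityˡ _)))

  -- No vertex of P has more neighbours outside P than in P.
  Balanced : (V G → Set) → Set
  Balanced P = ∀ x → P x → count (∁ P) x ≤ count P x

  -- A path from P to its complement contains a cut edge.
  crossing : ∀ {P : V G → Set} {u v} → Star (Adj G) u v → P u → ¬ P v →
    ∃₂ λ u v → P u × ¬ P v × Adj G u v
  crossing ε Pu ¬Pv = contradiction Pu ¬Pv
  crossing {P} (_◅_ {j = w} uw path) Pu ¬Pv with em {P w}
  ... | yes Pw = crossing path Pw ¬Pv
  ... | no ¬Pw = _ , w , Pu , ¬Pw , uw

  -- Every vertex of P has at most m cut edges.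
  AtMost : ℤ → (V G → Set) → Set
  AtMost m P = ∀ x → P x → count (∁ P) x ≤ m

  decrease : ∀ {P} m → AtMost (1ℤ + m) P → (∀ x → P x → count (∁ P) x ≢ 1ℤ + m) → AtMost m P
  decrease {P} m ≤1+m ≢1+m x Px = subst (count (∁ P) x ≤_) (ring m)
    (i<j⇒i≤pred[j] (≤∧≢⇒< (≤1+m x Px) (≢1+m x Px)))
    where
    ring : ∀ m → -1ℤ + (1ℤ + m) ≡ m
    ring = solve-∀

  AtMost-∁ : ∀ {P m} → AtMost m (∁ P) → ∀ w → ¬ P w → count P w ≤ m
  AtMost-∁ {P} {m} ≤m w ¬Pw = subst (_≤ m) (count-¬¬ P w) (≤m w ¬Pw)

  AtMost-¬¬ : ∀ {P m} → AtMost m P → AtMost m (∁ (∁ P))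
  AtMost-¬¬ {P} {m} ≤m w ¬¬Pw with em {P w}
  ... | yes Pw = subst (_≤ m) (sym (count-¬¬ (∁ P) w)) (≤m w Pw)
  ... | no ¬Pw = contradiction ¬Pw ¬¬Pw

  module _ {P C} (cut : CutSet P C) (thick : Thick (length C)) where

    crossing≤2 : Balanced P → AtMost (+ 2) P
    crossing≤2 balanced x Px with + 3 ≤? count (∁ P) x
    ... | yes 3≤ = ⊥-elim (crossing≥3-absurd cut Px thick 3≤ (balanced x Px))
    ... | no 3≰  = i<j⇒i≤pred[j] (≰⇒> 3≰)

    crossing≤1 : AtMost (+ 2) P → AtMost (+ 2) (∁ P) → AtMost 1ℤ P
    crossing≤1 ≤2 ≤2′ = decrease 1ℤ ≤2 λ x Px ≡2 → crossing≡2-absurd cut Px thick ≡2 (AtMost-∁ ≤2′)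

    crossing≤0 : AtMost 1ℤ P → AtMost 1ℤ (∁ P) → AtMost 0ℤ P
    crossing≤0 ≤1 ≤1′ = decrease 0ℤ ≤1 λ x Px ≡1 → crossing≡1-absurd cut Px thick ≡1 (AtMost-∁ ≤1′)

  swap-thick : ∀ (C : List (V G × V G)) → Thick (length C) → Thick (length (List.map swap C))
  swap-thick C thick y = subst (λ m → + m + + 2 ≤ deg y) (sym (length-map swap C)) (thick y)

  -- The maximal number of cut edges at a vertex decreases from 2 to 1 to 0.  Each
  -- step is applied on both sides of the cut; for the complement of P as P, the
  -- other side is the double complement.
  no-balanced-cut : ∀ {P C} → CutSet P C → Thick (length C) → Balanced P → Balanced (∁ P) →
    ∀ {u v} → P u → ¬ P v → ⊥
  no-balanced-cut {P} {C} cut thick bal bal′ Pu ¬Pv with crossing {P} (connected _ _) Pu ¬Pv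
  ... | u , v , Pu , ¬Pv , uv = <-irrefl {0ℤ} refl (<-≤-trans (+<+ (ℕ.s≤s ℕ.z≤n))
      (≤-trans 1≤ (crossing≤0 cut thick ≤1P ≤1P′ u Pu)))
    where
    cut′ = CutSet-swap cut
    thick′ = swap-thick C thick
    ≤2P  = crossing≤2 cut thick bal
    ≤2P′ = crossing≤2 cut′ thick′ bal′
    ≤1P  = crossing≤1 cut thick ≤2P ≤2P′
    ≤1P′ : AtMost 1ℤ (∁ P)
    ≤1P′ = crossing≤1 cut′ thick′ ≤2P′ (AtMost-¬¬ ≤2P)
    1≤ : 1ℤ ≤ count (∁ P) u
    1≤ = subst (_≤ count (∁ P) u) (⟦⟧-yes ¬Pv)
      (Σ-∈ {f = λ z → ⟦ ¬ P z ⟧} (λ _ → 0≤⟦⟧ _) (Equivalence.from (∈-nbrs {G} lf) uv))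

  length-filter : ∀ {A : Set} (Q : A → Set) l → + length (filter (λ z → em {Q z}) l) ≡ Σ l (λ z → ⟦ Q z ⟧)
  length-filter Q []      = refl
  length-filter Q (z ∷ l) with em {Q z}
  ... | yes _ = cong (λ t → 1ℤ + t) (length-filter Q l)
  ... | no _  = trans (length-filter Q l) (sym (+-identityˡ _))

  -- Moving an unbalanced vertex x out of P removes its cut edges and turns its
  -- edges into P into cut edges.
  module Move {P : V G → Set} {C : List (V G × V G)} (cut : CutSet P C) (thick : Thick (length C))
    {x : V G} (Px : P x) (unbalanced : count P x < count (∁ P) x) where

    P′ : V G → Set
    P′ z = P z × z ≢ x

    C′ : List (V G × V G)
    C′ = filter (λ e → em {proj₁ e ≢ x}) C ++ List.map (_, x) (filter (λ z → em {P z}) (N x))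

    cut′ : CutSet P′ C′
    cut′ {u} {v} (Pu , u≢x) ¬P′v uv with em {P v}
    ... | no ¬Pv = ∈-++⁺ˡ (∈-filter⁺ (λ e → em {proj₁ e ≢ x}) (cut Pu ¬Pv uv) u≢x)
    ... | yes Pv with em {v ≡ x}
    ...   | no v≢x   = contradiction (Pv , v≢x) ¬P′v
    ...   | yes refl = ∈-++⁺ʳ (filter (λ e → em {proj₁ e ≢ x}) C) (∈-map⁺ (_, x)
                         (∈-filter⁺ (λ z → em {P z}) (Equivalence.from (∈-nbrs {G} lf) (symm G uv)) Pu))

    length-C′ : + length C′ ≡ Σ C (λ e → ⟦ proj₁ e ≢ x ⟧) + count P x
    length-C′ = trans (cong +_ (length-++ (filter (λ e → em {proj₁ e ≢ x}) C)))
      (cong₂ _+_ (length-filter (λ e → proj₁ e ≢ x) C)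
        (trans (cong +_ (length-map (_, x) (filter (λ z → em {P z}) (N x)))) (length-filter P (N x))))

    length-C : + length C ≡ fibre C proj₁ x + Σ C (λ e → ⟦ proj₁ e ≢ x ⟧)
    length-C = trans (sym (Σ-1 C))
      (trans (Σ-cong C (λ {e} _ → ⟦⟧-¬ (proj₁ e ≡ x))) (Σ-+ C _ _))

    shorter : length C′ ℕ.< length C
    shorter = drop‿+<+ (subst₂ _<_ (sym length-C′) (sym length-C)
      (subst (_< fibre C proj₁ x + Σ C (λ e → ⟦ proj₁ e ≢ x ⟧)) (+-comm (count P x) _)
        (+-monoˡ-< _ (<-≤-trans unbalanced (count≤fibre cut Px)))))

    -- Otherwise all neighbours of x are across the cut, so that deg x ≤ k.
    nonempty : ∃[ y ] P′ y
    nonempty with em {∃[ y ] P′ y}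
    ... | yes inhabited = inhabited
    ... | no  empty     = contradiction deg<deg (<-irrefl refl)
      where
      no-near : count P x ≡ 0ℤ
      no-near = trans (Σ-cong (N x) (λ {z} z∈ → ⟦⟧-no λ Pz → empty (z , Pz , λ { refl →
        irrefl G (Equivalence.to (∈-nbrs {G} lf) z∈) }))) (Σ-zero (N x))
      deg≤C : deg x ≤ + length C
      deg≤C = ≤-trans (≤-reflexive (trans (deg-split P x)
          (trans (cong (λ t → t + count (∁ P) x) no-near) (+-identityˡ _))))
        (≤-trans (count≤fibre cut Px)
          (subst (fibre C proj₁ x ≤_) (Σ-1 C) (Σ-mono C (λ {e} _ → ⟦⟧≤1 (proj₁ e ≡ x)))))
      deg<deg : deg x < deg x
      deg<deg = ≤-<-trans deg≤C (<-≤-trans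
        (subst (_< + length C + + 2) (+-identityʳ _) (+-monoʳ-< (+ length C) (+<+ (ℕ.s≤s ℕ.z≤n)))) (thick x))

    thick′ : Thick (length C′)
    thick′ y = ≤-trans (+-monoˡ-≤ (+ 2) (+≤+ (ℕ.<⇒≤ shorter))) (thick y)

  -- Induction on the length of C.
  no-cut : ∀ {P C} → Acc ℕ._<_ (length C) → CutSet P C → Thick (length C) →
    ∀ {u v} → P u → ¬ P v → ⊥
  no-cut {P} {C} (acc smaller) cut thick {u} {v} Pu ¬Pv
    with em {∃[ x ] (P x × count P x < count (∁ P) x)}
       | em {∃[ x ] (¬ P x × count (∁ P) x < count (∁ (∁ P)) x)}
  ... | yes (x , Px , unbalanced) | _ =
    no-cut (smaller M.shorter) M.cut′ M.thick′ (proj₂ M.nonempty) (λ P′x → proj₂ P′x refl)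
    where module M = Move cut thick Px unbalanced
  ... | no _ | yes (x , ¬Px , unbalanced) =
    no-cut (smaller (subst (length M.C′ ℕ.<_) (length-map swap C) M.shorter)) M.cut′ M.thick′
      (proj₂ M.nonempty) (λ P′x → proj₂ P′x refl)
    where module M = Move (CutSet-swap cut) (swap-thick C thick) ¬Px unbalanced
  ... | no none | no none′ = no-balanced-cut cut thick
    (λ x Px → ≮⇒≥ λ lt → none (x , Px , lt)) (λ x ¬Px → ≮⇒≥ λ lt → none′ (x , ¬Px , lt)) Pu ¬Pv

-- The cut obtained from a disconnecting list of edges F: the set of vertices
-- reachable from u in G - F.
module Reach (em : ExcludedMiddle 0ℓ) {G : Graph} (F : List (Edge G)) (u : V G) where

  Reachable : V G → Set
  Reachable z = Star (Adj (G ─ F)) u z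

  -- An edge {a, b} as an ordered pair whose first entry is reachable, if one end is
  -- reachable and the other is not.
  orient : Edge G → V G × V G
  orient (a , b , _) with em {Reachable a}
  ... | yes _ = a , b
  ... | no  _ = b , a

  orient-joins : ∀ {a b} → Reachable a → ¬ Reachable b → ∀ e → Joins {G} a b e → (a , b) ≡ orient e
  orient-joins Ra ¬Rb (a , b , _) (inj₁ (refl , refl)) with em {Reachable a}
  ... | yes _  = refl
  ... | no ¬Ra = contradiction Ra ¬Ra
  orient-joins Ra ¬Rb (b , a , _) (inj₂ (refl , refl)) with em {Reachable b}
  ... | yes Rb = contradiction Rb ¬Rb
  ... | no _   = refl

  reach-cut : ∀ {a b} → Reachable a → ¬ Reachable b → Adj G a b → (a , b) ∈ List.map orient F
  reach-cut {a} {b} Ra ¬Rb ab with em {Any (Joins {G} a b) F}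
  ... | yes ab∈F = Any.map⁺ (Any.map (λ {e} → orient-joins Ra ¬Rb e) ab∈F)
  ... | no  ab∉F = contradiction (Ra ◅◅ (ab , ab∉F) ◅ ε) ¬Rb

theorem1p3 : ExcludedMiddle 0ℓ →
    (G : Graph) (lf : LocallyFinite G) (δ : ℕ) →
    Connected G →
    IsMinDegree lf δ →
    0ᴿ ≤∞ K-BE lf →
    EdgeConnected G (δ ∸ 1)
theorem1p3 em G lf δ connected ((x₀ , deg-x₀≡δ) , δ≤deg) K≥0 =
  (λ _ F F<δ-1 u v → decidable-stable em λ ¬Rv →
    no-cut {Reach.Reachable em {G} F u} {List.map (Reach.orient em {G} F u) F} (<-wellFounded _)
      (Reach.reach-cut em {G} F u) (thick F F<δ-1 (Reach.orient em {G} F u)) ε ¬Rv) ,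
  λ all≡ → cong (_∸ 1) (δ≡0 all≡)
  where
  curved : ∀ f x → 0ℤ ≤ 4Γ₂ᶻ {G} lf f x
  curved f x = 4Γ₂ᶻ-nonneg {G} lf K≥0 f x (subst (0ℤ ≤_) (sym (2Γᶻ-Σ {G} lf f f x))
    (Σ-nonneg (nbrs {G} lf x) (λ {y} _ → sq-nonneg (f y - f x))))

  open Global em {G} lf connected curved using (Thick; no-cut)

  δ≡0 : (∀ x y → x ≡ y) → δ ≡ 0
  δ≡0 all≡ = trans (sym deg-x₀≡δ) (length≡0 (nbrs {G} lf x₀) λ z∈ →
    irrefl G (subst (Adj G x₀) (all≡ _ x₀) (Equivalence.to (∈-nbrs {G} lf) z∈)))
    where
    length≡0 : (l : List (V G)) → (∀ {z} → ¬ (z ∈ l)) → length l ≡ 0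
    length≡0 []      _  = refl
    length≡0 (z ∷ l) z∉ = contradiction (here refl) z∉

  m+2≤δ : ∀ {m δ} → m ℕ.< δ ∸ 1 → m ℕ.+ 2 ℕ.≤ δ
  m+2≤δ {m} {ℕ.suc δ} m<δ = subst (ℕ._≤ ℕ.suc δ) (ℕ.+-comm 2 m) (ℕ.s≤s m<δ)

  thick : ∀ F → length F ℕ.< δ ∸ 1 → (orient : Edge G → V G × V G) → Thick (length (List.map orient F))
  thick F F<δ-1 orient y = subst₂ (λ m d → + m + + 2 ≤ d)
    (sym (length-map orient F)) (sym (Σ-1 (nbrs {G} lf y)))
    (+≤+ (ℕ.≤-trans (m+2≤δ F<δ-1) (δ≤deg y)))
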